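{- Let $p>0$ and $x\ge 0$ be fixed. For $n\ge 1$ let $$\rho_n=\min_{0\le a\le n}\ \max_{v\in\{p,x\}^n}\frac{\mathrm{ALG}(T^aE^{n-a},v)}{\mathrm{OPT}(v)}$$ be the competitive ratio of the scheduling problem with $n$ jobs for non-adaptive (two-phase) algorithms. Then the asymptotic competitive ratio $\lim_{n\to\infty}\rho_n$ equals $$\sqrt{1+\frac{x}{p}}\qquad\text{when } 0\le x<2+\frac1p,$$ and $$1+\frac{x^2-px-1+\sqrt{\Delta'}}{2px^2}\qquad\text{when } x\ge 2+\frac1p,$$ where $\Delta'=8p(x-1)x^2+(1+px-x^2)^2$.
   Context: There are $n$ jobs, numbered $1,\dots,n$, to be scheduled on a single machine so as to minimize the sum of completion times. Each job is either short (processing time $p$) or long (processing time $p+x$); which jobs are long is initially unknown to the algorithm. Jobs are handled in index order. For each job $j$ the algorithm either tests it ($u_j=T$; the test takes one time unit and reveals the processing time; a tested short job is executed immediately after its test, a tested long job is postponed to the end of the schedule) or executes it untested ($u_j=E$). The adversary decides whether job $j$ is short ($v_j=p$) or long ($v_j=x$); here $T,E,p,x$ are used as symbols in the strategy strings. In the non-adaptive model the algorithm first fixes $u$, and the adversary then chooses $v$ knowing $u$. Only two-phase strategies $u=T^aE^{n-a}$ (test the first $a$ jobs, execute the remaining ones untested) are considered. For $u\in\{T,E\}^n$, $v\in\{p,x\}^n$, the cost $\mathrm{ALG}(u,v)$ (total completion time of the schedule) is obtained as follows. Start with $A=p\,n(n+1)/2$ and $r=n$. For $j=1,\dots,n$: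 if $u_j=E,v_j=p$, decrease $r$ by $1$; if $u_j=E,v_j=x$, add $rx$ to $A$ and then decrease $r$ by $1$; if $u_j=T,v_j=p$, add $r$ to $A$ and then decrease $r$ by $1$; if $u_j=T,v_j=x$, add $r$ to $A$. Finally add $x\,r(r+1)/2$ to $A$; the result is $\mathrm{ALG}(u,v)$. With $\ell=|\{j:v_j=x\}|$, the optimal cost is $\mathrm{OPT}(v)=\bigl(p\,n(n+1)+x\,\ell(\ell+1)\bigr)/2$. -}

module Defs where

open import Algebra.Apartness.Bundles using (HeytingCommutativeRing; HeytingField)
open import Algebra.Bundles using (CommutativeRing)
import Algebra.Properties.Monoid.Mult as Mult
import Algebra.Properties.Ring as RingProperties
open import Data.Nat.Base as ℕ using (ℕ; zero; suc; pred; NonZero)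
open import Data.Product.Base using (∃-syntax; _×_; _,_; proj₁; proj₂)
open import Data.Sum.Base using (_⊎_; inj₁; inj₂; [_,_]′)
open import Data.Vec.Base using (Vec; []; _∷_)
open import Function.Base using (_∘_)
open import Function.Bundles using (_⇔_; Equivalence)
import Level as L
open import Relation.Binary.Core using (Rel)
open import Relation.Binary.Lattice.Structures using (IsLattice)
open import Relation.Binary.Structures using (IsStrictPartialOrder)
open import Relation.Nullary.Negation using (¬_; contradiction)

-- The library has no real numbers, so they are axiomatised as a complete
-- Archimedean ordered field, which is unique up to isomorphism.  The
-- axioms are constructive: _<_ is cotransitive (as _#_ is) rather than
-- decidable, and x ≤ y means ¬ (y < x).  The lattice operations and the
-- square root are fields because an undecidable order does not allow
-- defining them by cases.
record RealField c ℓ₁ ℓ₂ : Set (L.suc (c L.⊔ ℓ₁ L.⊔ ℓ₂)) where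
  field
    heytingField : HeytingField c ℓ₁ ℓ₂

  open HeytingField heytingField public
  open HeytingCommutativeRing heytingCommutativeRing public using (commutativeRing)
  open CommutativeRing commutativeRing public using (+-monoid; ring)
  open Mult +-monoid using () renaming (_×_ to _×ℕ_)

  infix  4 _<_ _≤_ _⟶_
  infixl 6 _⊔_
  infixl 7 _⊓_ _/_[_]
  infix  9 _² √_

  field
    _<_                    : Rel Carrier ℓ₂
    <-isStrictPartialOrder : IsStrictPartialOrder _≈_ _<_
    #⇔<⊎>                  : ∀ x y → x # y ⇔ (x < y ⊎ y < x)
    +-monoˡ-<              : ∀ z {x y} → x < y → x + z < y + z
    *-pos                  : ∀ {x y} → 0# < x → 0# < y → 0# < x * y

  _≤_ : Rel Carrier ℓ₂
  x ≤ y = ¬ (y < x)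

  field
    _⊔_ _⊓_   : Carrier → Carrier → Carrier
    isLattice : IsLattice _≈_ _≤_ _⊔_ _⊓_

  fromℕ : ℕ → Carrier
  fromℕ n = n ×ℕ 1#

  ∣_∣ : Carrier → Carrier
  ∣ x ∣ = x ⊔ (- x)

  _⟶_ : (ℕ → Carrier) → Carrier → Set (c L.⊔ ℓ₂)
  s ⟶ l = ∀ ε → 0# < ε → ∃[ N ] ∀ n → N ℕ.≤ n → ∣ s n - l ∣ < ε

  Cauchy : (ℕ → Carrier) → Set (c L.⊔ ℓ₂)
  Cauchy s = ∀ ε → 0# < ε →
    ∃[ N ] ∀ m n → N ℕ.≤ m → N ℕ.≤ n → ∣ s m - s n ∣ < ε

  field
    archimedean : ∀ x → ∃[ n ] x < fromℕ n
    complete    : ∀ s → Cauchy s → ∃[ l ] s ⟶ l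

    -- The value of √ at negative arguments is irrelevant.
    √_       : Carrier → Carrier
    √-nonneg : ∀ {x} → 0# ≤ x → 0# ≤ √ x
    √-square : ∀ {x} → 0# ≤ x → √ x * √ x ≈ x

  0<x⇒x#0 : ∀ {x} → 0# < x → x # 0#
  0<x⇒x#0 0<x = Equivalence.from (#⇔<⊎> _ _) (inj₂ 0<x)

  _/_[_] : Carrier → (y : Carrier) → 0# < y → Carrier
  x / y [ 0<y ] = x * proj₁ (#⇒invertible (0<x⇒x#0 0<y))

  _² : Carrier → Carrier
  x ² = x * x

module RealFieldProperties {c ℓ₁ ℓ₂} (R : RealField c ℓ₁ ℓ₂) where
  open RealField R
  open RingProperties ring
    using (-‿involutive; -0#≈0#; -‿distribˡ-*; -‿distribʳ-*)
  open IsStrictPartialOrder <-isStrictPartialOrder public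
    using (<-resp-≈) renaming (trans to <-trans; irrefl to <-irrefl)

  <-respʳ : ∀ {x y z} → y ≈ z → x < y → x < z
  <-respʳ = proj₁ <-resp-≈

  <-respˡ : ∀ {x y z} → y ≈ z → y < x → z < x
  <-respˡ = proj₂ <-resp-≈

  <-cotrans : ∀ {x y} → x < y → ∀ z → x < z ⊎ z < y
  <-cotrans {x} {y} x<y z =
    [ (λ x#z → [ inj₁ , (λ z<x → inj₂ (<-trans z<x x<y)) ]′ (to x#z))
    , (λ z#y → [ inj₂ , (λ y<z → inj₁ (<-trans x<y y<z)) ]′ (to z#y)) ]′
    (#-cotrans (Equivalence.from (#⇔<⊎> _ _) (inj₁ x<y)) z)
    where
    to : ∀ {a b} → a # b → a < b ⊎ b < a
    to = Equivalence.to (#⇔<⊎> _ _)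

  <-≤-trans : ∀ {x y z} → x < y → y ≤ z → x < z
  <-≤-trans {z = z} x<y y≤z =
    [ (λ x<z → x<z) , (λ z<y → contradiction z<y y≤z) ]′ (<-cotrans x<y z)

  +-cancelʳ-0< : ∀ {x y} → x + y < y → x < 0#
  +-cancelʳ-0< {x} {y} x+y<y =
    <-respʳ (-‿inverseʳ y)
      (<-respˡ
        (trans (+-assoc x y (- y)) (trans (+-cong refl (-‿inverseʳ y)) (+-identityʳ x)))
        (+-monoˡ-< (- y) x+y<y))

  pos+nonneg : ∀ {x y} → 0# < x → 0# ≤ y → 0# < x + y
  pos+nonneg {x} {y} 0<x 0≤y = <-≤-trans 0<x
    (λ x+y<x → 0≤y (+-cancelʳ-0< (<-respˡ (+-comm x y) x+y<x)))

  nonneg+nonneg : ∀ {x y} → 0# ≤ x → 0# ≤ y → 0# ≤ x + y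
  nonneg+nonneg {x} {y} 0≤x 0≤y x+y<0 =
    [ (λ x+y<y → 0≤x (+-cancelʳ-0< x+y<y)) , 0≤y ]′ (<-cotrans x+y<0 y)

  <⇒≤ : ∀ {x y} → x < y → x ≤ y
  <⇒≤ x<y y<x = <-irrefl refl (<-trans x<y y<x)

  neg-pos : ∀ {x} → x < 0# → 0# < - x
  neg-pos {x} x<0 =
    <-respʳ (+-identityˡ (- x)) (<-respˡ (-‿inverseʳ x) (+-monoˡ-< (- x) x<0))

  0<1 : 0# < 1#
  0<1 = [ (λ 1<0 → <-respʳ -1*-1≈1 (*-pos (neg-pos 1<0) (neg-pos 1<0)))
        , (λ 0<1 → 0<1) ]′ (Equivalence.to (#⇔<⊎> _ _) 1#0)
    where
    -1*-1≈1 : (- 1#) * (- 1#) ≈ 1#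
    -1*-1≈1 = trans (sym (-‿distribˡ-* 1# (- 1#)))
      (trans (-‿cong (*-identityˡ (- 1#))) (-‿involutive 1#))

    1-0≈1 : 1# - 0# ≈ 1#
    1-0≈1 = trans (+-cong refl -0#≈0#) (+-identityʳ 1#)

    1#0 : 1# # 0#
    1#0 = invertible⇒# (1# , trans (*-identityˡ _) 1-0≈1 , trans (*-identityʳ _) 1-0≈1)

  fromℕ-nonneg : ∀ n → 0# ≤ fromℕ n
  fromℕ-nonneg zero    = <-irrefl refl
  fromℕ-nonneg (suc n) = nonneg+nonneg (<⇒≤ 0<1) (fromℕ-nonneg n)

  fromℕ-pos : ∀ n .{{_ : NonZero n}} → 0# < fromℕ n
  fromℕ-pos (suc n) = pos+nonneg 0<1 (fromℕ-nonneg n)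

  *-fromℕ-nonneg : ∀ {x} → 0# ≤ x → ∀ n → 0# ≤ x * fromℕ n
  *-fromℕ-nonneg {x} 0≤x zero    = <-irrefl refl ∘ <-respˡ (zeroʳ x)
  *-fromℕ-nonneg {x} 0≤x (suc n) =
    nonneg+nonneg 0≤x (*-fromℕ-nonneg 0≤x n)
    ∘ <-respˡ (trans (distribˡ x 1# (fromℕ n)) (+-cong (*-identityʳ x) refl))

  /-inverseʳ : ∀ {y} (0<y : 0# < y) → y * (1# / y [ 0<y ]) ≈ 1#
  /-inverseʳ {y} 0<y with #⇒invertible (0<x⇒x#0 0<y)
  ... | y⁻¹ , _ , y*y⁻¹≈1 =
    trans (*-cong (sym (trans (+-cong refl -0#≈0#) (+-identityʳ y))) (*-identityˡ y⁻¹))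
      y*y⁻¹≈1

  1/-pos : ∀ {y} (0<y : 0# < y) → 0# < 1# / y [ 0<y ]
  1/-pos {y} 0<y =
    [ (λ i<0 → contradiction (0<-1 i<0) (<⇒≤ -1<0)) , (λ 0<i → 0<i) ]′
    (Equivalence.to (#⇔<⊎> _ _) i#0)
    where
    i = 1# / y [ 0<y ]

    i-0≈i : i - 0# ≈ i
    i-0≈i = trans (+-cong refl -0#≈0#) (+-identityʳ i)

    i#0 : i # 0#
    i#0 = invertible⇒#
      ( y
      , trans (*-cong refl i-0≈i) (/-inverseʳ 0<y)
      , trans (*-cong i-0≈i refl) (trans (*-comm i y) (/-inverseʳ 0<y)))

    0<-1 : i < 0# → 0# < - 1#
    0<-1 i<0 = <-respʳ
      (trans (sym (-‿distribʳ-* y i)) (-‿cong (/-inverseʳ 0<y)))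
      (*-pos 0<y (neg-pos i<0))

    -1<0 : - 1# < 0#
    -1<0 = <-respʳ (-‿inverseʳ 1#) (<-respˡ (+-identityˡ (- 1#)) (+-monoˡ-< (- 1#) 0<1))

  /-pos : ∀ {x y} → 0# < x → (0<y : 0# < y) → 0# < x / y [ 0<y ]
  /-pos 0<x 0<y = *-pos 0<x (<-respʳ (*-identityˡ _) (1/-pos 0<y))

  0<2 : 0# < fromℕ 2
  0<2 = fromℕ-pos 2

data Action : Set where
  T E : Action        -- test / execute untested

data Kind : Set where
  short long : Kind   -- processing time p / p + x

-- The strategy TᵃEⁿ⁻ᵃ, meaningful for a ≤ n.
twoPhase : ℕ → (n : ℕ) → Vec Action n
twoPhase _       zero    = []
twoPhase zero    (suc n) = E ∷ twoPhase zero n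
twoPhase (suc a) (suc n) = T ∷ twoPhase a n

#long : ∀ {n} → Vec Kind n → ℕ
#long []          = 0
#long (short ∷ v) = #long v
#long (long  ∷ v) = suc (#long v)

module Scheduling {c ℓ₁ ℓ₂} (R : RealField c ℓ₁ ℓ₂) where
  open RealField R
  open RealFieldProperties R

  module _ (p x : Carrier) where

    -- A is the cost accumulated so far and r the number of jobs not yet
    -- executed.
    cost : ∀ {n} → Vec Action n → Vec Kind n → Carrier → ℕ → Carrier
    cost []      []          A r = A + x * fromℕ (r ℕ.* (r ℕ.+ 1)) / fromℕ 2 [ 0<2 ]
    cost (E ∷ u) (short ∷ v) A r = cost u v A (pred r)
    cost (E ∷ u) (long  ∷ v) A r = cost u v (A + fromℕ r * x) (pred r)
    cost (T ∷ u) (short ∷ v) A r = cost u v (A + fromℕ r) (pred r)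
    cost (T ∷ u) (long  ∷ v) A r = cost u v (A + fromℕ r) r

    ALG : ∀ {n} → Vec Action n → Vec Kind n → Carrier
    ALG {n} u v = cost u v (p * fromℕ (n ℕ.* (n ℕ.+ 1)) / fromℕ 2 [ 0<2 ]) n

    OPT : ∀ {n} → Vec Kind n → Carrier
    OPT {n} v =
      (p * fromℕ (n ℕ.* (n ℕ.+ 1)) + x * fromℕ (#long v ℕ.* (#long v ℕ.+ 1)))
      / fromℕ 2 [ 0<2 ]

    OPT-pos : 0# < p → 0# ≤ x → ∀ {n} .{{_ : NonZero n}} (v : Vec Kind n) → 0# < OPT v
    OPT-pos 0<p 0≤x {suc n} v = /-pos
      (pos+nonneg (*-pos 0<p (fromℕ-pos (suc n ℕ.* (suc n ℕ.+ 1))))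
                  (*-fromℕ-nonneg 0≤x (#long v ℕ.* (#long v ℕ.+ 1))))
      0<2

  maxKinds : ∀ n → (Vec Kind n → Carrier) → Carrier
  maxKinds zero    f = f []
  maxKinds (suc n) f =
    maxKinds n (λ v → f (short ∷ v)) ⊔ maxKinds n (λ v → f (long ∷ v))

  minUpTo : ℕ → (ℕ → Carrier) → Carrier
  minUpTo zero    f = f 0
  minUpTo (suc n) f = minUpTo n f ⊓ f (suc n)

  module _ (p x : Carrier) (0<p : 0# < p) (0≤x : 0# ≤ x) where

    ρ : (n : ℕ) .{{_ : NonZero n}} → Carrier
    ρ n = minUpTo n λ a → maxKinds n λ v →
      ALG p x (twoPhase a n) v / OPT p x v [ OPT-pos p x 0<p 0≤x v ]

  2px²-pos : ∀ {p x} (0<p : 0# < p) → fromℕ 2 + 1# / p [ 0<p ] ≤ x →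
             0# < fromℕ 2 * p * x ²
  2px²-pos {p} {x} 0<p 2+1/p≤x = *-pos (*-pos 0<2 0<p) (*-pos 0<x 0<x)
    where
    0<x : 0# < x
    0<x = <-≤-trans (pos+nonneg 0<2 (<⇒≤ (1/-pos 0<p))) 2+1/p≤x

{-# OPTIONS --safe #-}
module Submission where

-- For given numbers of long jobs among the tested and the untested ones, the
-- adversary does best to put the long ones first in either phase.  If l of the
-- a tested and m of the b untested jobs are long, then up to terms linear in n
--
--   2 (ALG - (1 + s) OPT) = 2an - (a - l)² + 2xm(b - m) - sp n² - sx (l + m)²,
--
-- a concave quadratic in (l, m).  The limit is 1 + s for the s at which its
-- maximum over l and m, minimised over a, vanishes; rounding the real optimum
-- to integers costs O(1), which is negligible against OPT ≥ pn²/2.  For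
-- x < 2 + 1/p the minimum is at a = 0 and s solves x = ps(s + 2).  Otherwise
-- eliminating l and m leaves a convex quadratic in a whose minimum vanishes
-- exactly when px²s² - (x² - px - 1)s - 2(x - 1) = 0.

-- The real maximiser (l, m) need not lie in the box 0 ≤ l ≤ a, 0 ≤ m ≤ b. For the upper bound this
-- is harmless: one good `a` is chosen, and the maximum over all real l and m bounds every string.
-- For the lower bound every `a` must be answered, and when l or m would be negative the maximum on
-- the corresponding edge has to be shown nonnegative separately. The order being undecidable, these
-- cases are joined under a double negation.
--
-- The quadratic inequalities are proved by certificates: the difference of the two sides, times a
-- positive factor where needed, is an explicit sum of nonnegative products, up to an explicit
-- multiple of the equation defining s.
--
-- The threshold 2 + 1/p is the value of x at which s p = 1. With l = 0, the presence of tests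
-- changes the quadratic by (1 - s p)(a² + 2ab), so testing cannot help while s p ≤ 1.

open import Defs
open import Algebra.Bundles using (CommutativeRing)
import Algebra.Properties.AbelianGroup as AbelianGroupProperties
import Algebra.Properties.Monoid.Mult as Mult
import Algebra.Properties.Ring as RingProperties
import Algebra.Properties.Semiring.Mult as MultSemiring
import Algebra.Properties.Semiring.Mult.TCOptimised as Mult′
import Algebra.Solver.Ring as RingSolver
open import Algebra.Solver.Ring.AlmostCommutativeRing
  using (fromCommutativeRing; _-Raw-AlmostCommutative⟶_)
open import Data.Integer.Base as ℤ using (ℤ; +_; -[1+_]; _⊖_; _◃_)
import Data.Integer.Properties as ℤₚ
import Data.Maybe.Base as Maybe
open import Data.Nat.Base as ℕ using (ℕ; zero; suc; pred; NonZero; s≤s; z≤n)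
import Data.Nat.Properties as ℕₚ
open import Data.Product.Base using (∃-syntax; _×_; _,_; proj₁; proj₂)
open import Data.Sign.Base as Sign using (Sign)
open import Data.Sum.Base using (inj₁; inj₂; [_,_]′)
open import Data.Vec.Base using (Vec; []; _∷_)
open import Relation.Binary.Lattice.Structures using (IsLattice)
open import Relation.Binary.PropositionalEquality as ≡ using (_≡_)
open import Relation.Nullary.Decidable.Core using (dec⇒maybe)
open import Relation.Nullary.Negation using (¬_; contradiction)
import Relation.Binary.Reasoning.Setoid as SetoidReasoning

-- The ring solver needs a decidable equality of coefficients, which a ring
-- of real numbers lacks; hence coefficients in ℤ.
module IntegerCoefficients {c ℓ} (R : CommutativeRing c ℓ) where
  open CommutativeRing R
  open RingProperties ring using (-0#≈0#; -‿distribˡ-*; -‿distribʳ-*; -‿involutive)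
  open AbelianGroupProperties +-abelianGroup using () renaming (⁻¹-∙-comm to -‿+-comm)
  open Mult′ semiring using (×-homo-+; ×1-homo-*; 1+×) renaming (_×_ to _×′_)
  open SetoidReasoning setoid

  private
    ⟦_⟧ : ℤ → Carrier
    ⟦ + n ⟧      = n ×′ 1#
    ⟦ -[1+ n ] ⟧ = - (suc n ×′ 1#)

    -‿homo : ∀ i → ⟦ ℤ.- i ⟧ ≈ - ⟦ i ⟧
    -‿homo (+ zero)  = sym -0#≈0#
    -‿homo (+ suc n) = refl
    -‿homo -[1+ n ]  = sym (-‿involutive _)

    ⊖-homo : ∀ m n → ⟦ m ⊖ n ⟧ ≈ m ×′ 1# - n ×′ 1#
    ⊖-homo zero    zero    = sym (-‿inverseʳ 0#)
    ⊖-homo zero    (suc n) = sym (+-identityˡ _)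
    ⊖-homo (suc m) zero    = sym (trans (+-congˡ -0#≈0#) (+-identityʳ _))
    ⊖-homo (suc m) (suc n) = begin
      ⟦ suc m ⊖ suc n ⟧                    ≡⟨ ≡.cong ⟦_⟧ (ℤₚ.[1+m]⊖[1+n]≡m⊖n m n) ⟩
      ⟦ m ⊖ n ⟧                            ≈⟨ ⊖-homo m n ⟩
      M - N                                ≈⟨ +-congʳ (+-identityʳ M) ⟨
      (M + 0#) - N                         ≈⟨ +-congʳ (+-congˡ (-‿inverseʳ 1#)) ⟨
      (M + (1# - 1#)) - N                  ≈⟨ +-congʳ (+-assoc M 1# (- 1#)) ⟨
      ((M + 1#) - 1#) - N                  ≈⟨ +-assoc (M + 1#) (- 1#) (- N) ⟩
      (M + 1#) + (- 1# - N)                ≈⟨ +-cong (trans (+-comm M 1#) (sym (1+× m 1#)))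
                                                (trans (-‿+-comm 1# N) (-‿cong (sym (1+× n 1#)))) ⟩
      suc m ×′ 1# - suc n ×′ 1#            ∎
      where
      M = m ×′ 1#
      N = n ×′ 1#

    +-homo : ∀ i j → ⟦ i ℤ.+ j ⟧ ≈ ⟦ i ⟧ + ⟦ j ⟧
    +-homo (+ m)    (+ n)    = ×-homo-+ 1# m n
    +-homo (+ m)    -[1+ n ] = ⊖-homo m (suc n)
    +-homo -[1+ m ] (+ n)    = trans (⊖-homo n (suc m)) (+-comm _ _)
    +-homo -[1+ m ] -[1+ n ] = begin
      - (suc (suc (m ℕ.+ n)) ×′ 1#)        ≡⟨ ≡.cong (λ k → - (suc k ×′ 1#)) (≡.sym (ℕₚ.+-suc m n)) ⟩
      - ((suc m ℕ.+ suc n) ×′ 1#)          ≈⟨ -‿cong (×-homo-+ 1# (suc m) (suc n)) ⟩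
      - (suc m ×′ 1# + suc n ×′ 1#)        ≈⟨ -‿+-comm _ _ ⟨
      - (suc m ×′ 1#) - suc n ×′ 1#        ∎

    +◃-homo : ∀ n → ⟦ Sign.+ ◃ n ⟧ ≈ n ×′ 1#
    +◃-homo n = reflexive (≡.cong ⟦_⟧ (ℤₚ.+◃n≡+n n))

    -◃-homo : ∀ n → ⟦ Sign.- ◃ n ⟧ ≈ - (n ×′ 1#)
    -◃-homo n = trans (reflexive (≡.cong ⟦_⟧ (ℤₚ.-◃n≡-n n))) (-‿homo (+ n))

    *-homo : ∀ i j → ⟦ i ℤ.* j ⟧ ≈ ⟦ i ⟧ * ⟦ j ⟧
    *-homo (+ m)    (+ n)    = trans (+◃-homo (m ℕ.* n)) (×1-homo-* m n)
    *-homo (+ m)    -[1+ n ] = trans (-◃-homo (m ℕ.* suc n))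
      (trans (-‿cong (×1-homo-* m (suc n))) (-‿distribʳ-* _ _))
    *-homo -[1+ m ] (+ n)    = trans (-◃-homo (suc m ℕ.* n))
      (trans (-‿cong (×1-homo-* (suc m) n)) (-‿distribˡ-* _ _))
    *-homo -[1+ m ] -[1+ n ] = begin
      ⟦ Sign.+ ◃ suc m ℕ.* suc n ⟧         ≈⟨ +◃-homo (suc m ℕ.* suc n) ⟩
      (suc m ℕ.* suc n) ×′ 1#              ≈⟨ ×1-homo-* (suc m) (suc n) ⟩
      suc m ×′ 1# * suc n ×′ 1#            ≈⟨ -‿involutive _ ⟨
      - (- (suc m ×′ 1# * suc n ×′ 1#))    ≈⟨ -‿cong (-‿distribʳ-* _ _) ⟩
      - (suc m ×′ 1# * - (suc n ×′ 1#))    ≈⟨ -‿distribˡ-* _ _ ⟩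
      - (suc m ×′ 1#) * - (suc n ×′ 1#)    ∎

    morphism : ℤ.+-*-rawRing -Raw-AlmostCommutative⟶ fromCommutativeRing R
    morphism = record
      { ⟦_⟧    = ⟦_⟧
      ; +-homo = +-homo
      ; *-homo = *-homo
      ; -‿homo = -‿homo
      ; 0-homo = refl
      ; 1-homo = refl
      }

  open RingSolver ℤ.+-*-rawRing (fromCommutativeRing R) morphism
    (λ i j → Maybe.map (λ i≡j → reflexive (≡.cong ⟦_⟧ i≡j)) (dec⇒maybe (i ℤₚ.≟ j))) public
    using (Polynomial; solve; con; _:+_; _:*_; _:-_; :-_; _:=_)

  :1 : ∀ {n} → Polynomial n
  :1 = con (+ 1)

  :ℕ : ∀ {n} → ℕ → Polynomial n
  :ℕ zero    = con (+ 0)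
  :ℕ (suc k) = :1 :+ :ℕ k

-- Ordered-field arithmetic, rounding, and finite maxima and minima.

module OrderedField {c ℓ₁ ℓ₂} (R : RealField c ℓ₁ ℓ₂) where
  open RealField R
  open RealFieldProperties R
  open IntegerCoefficients commutativeRing
  open IsLattice isLattice using (x≤x∨y; y≤x∨y; ∨-least; x∧y≤x; x∧y≤y; ∧-greatest; antisym)
  open Mult +-monoid using (×-homo-+)
  open MultSemiring (CommutativeRing.semiring commutativeRing) using (×1-homo-*)

  open IsLattice isLattice public
    using () renaming (refl to ≤-refl; trans to ≤-trans; reflexive to ≤-reflexive)

  infixl 6 _⊕_
  infixl 7 _⊗_

  ≤-respʳ : ∀ {x y z} → y ≈ z → x ≤ y → x ≤ z
  ≤-respʳ y≈z x≤y z<x = x≤y (<-respˡ (sym y≈z) z<x)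

  ≤-respˡ : ∀ {x y z} → y ≈ z → y ≤ x → z ≤ x
  ≤-respˡ y≈z y≤x x<z = y≤x (<-respʳ (sym y≈z) x<z)

  ≤-<-trans : ∀ {x y z} → x ≤ y → y < z → x < z
  ≤-<-trans {x} x≤y y<z = [ (λ y<x → contradiction y<x x≤y) , (λ x<z → x<z) ]′ (<-cotrans y<z x)

  _⊕_ : ∀ {x y} → 0# ≤ x → 0# ≤ y → 0# ≤ x + y
  _⊕_ = nonneg+nonneg

  x<y⇒0<y-x : ∀ {x y} → x < y → 0# < y - x
  x<y⇒0<y-x {x} x<y = <-respˡ (-‿inverseʳ x) (+-monoˡ-< (- x) x<y)

  0<y-x⇒x<y : ∀ {x y} → 0# < y - x → x < y
  0<y-x⇒x<y {x} {y} 0<y-x = <-respˡ (+-identityˡ x)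
    (<-respʳ (solve 2 (λ x y → (y :- x) :+ x := y) refl x y) (+-monoˡ-< x 0<y-x))

  x≤y⇒0≤y-x : ∀ {x y} → x ≤ y → 0# ≤ y - x
  x≤y⇒0≤y-x {x} {y} x≤y y-x<0 = x≤y (0<y-x⇒x<y
    (<-respʳ (solve 2 (λ x y → :- (y :- x) := x :- y) refl x y) (neg-pos y-x<0)))

  -- Entry point for certificates: `e` is a visibly nonnegative expression, and its equality with
  -- the difference is left to the ring solver.
  ≤-by : ∀ {x y e} → 0# ≤ e → e ≈ y - x → x ≤ y
  ≤-by 0≤e e≈y-x y<x = 0≤e (<-respˡ (sym e≈y-x) (<-respʳ (-‿inverseʳ _) (+-monoˡ-< _ y<x)))

  nonneg-by : ∀ {x e} → 0# ≤ e → e ≈ x → 0# ≤ x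
  nonneg-by 0≤e e≈x = ≤-respʳ e≈x 0≤e

  0≤2 : 0# ≤ fromℕ 2
  0≤2 = <⇒≤ 0<2

  -- No sign can be decided, but the goal is a negation. If `x * y < 0`, then `0 < x` would exclude
  -- `0 < y`, forcing y to be zero and the product to vanish; hence x is zero, and the product
  -- vanishes again.
  *-nonneg : ∀ {x y} → 0# ≤ x → 0# ≤ y → 0# ≤ x * y
  *-nonneg {x} {y} 0≤x 0≤y xy<0 = x≤0 0<x
    where
    y≤0⇒⊥ : ¬ (y ≤ 0#)
    y≤0⇒⊥ y≤0 = <-irrefl (trans (*-cong refl (antisym y≤0 0≤y)) (zeroʳ x)) xy<0

    x≤0 : x ≤ 0#
    x≤0 0<x = y≤0⇒⊥ (λ 0<y → <⇒≤ (*-pos 0<x 0<y) xy<0)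

    0<x : 0# < x
    0<x = contradiction (trans (*-cong (antisym x≤0 0≤x) refl) (zeroˡ y)) (λ xy≈0 → <-irrefl xy≈0 xy<0)

  _⊗_ : ∀ {x y} → 0# ≤ x → 0# ≤ y → 0# ≤ x * y
  _⊗_ = *-nonneg

  square-nonneg : ∀ x → 0# ≤ x * x
  square-nonneg x xx<0 = *-nonneg 0≤x 0≤x xx<0
    where
    0≤x : 0# ≤ x
    0≤x x<0 = <⇒≤ (*-pos (neg-pos x<0) (neg-pos x<0))
      (<-respˡ (solve 1 (λ x → x :* x := (:- x) :* (:- x)) refl x) xx<0)

  *-cancelˡ-nonneg : ∀ {c x} → 0# < c → 0# ≤ c * x → 0# ≤ x
  *-cancelˡ-nonneg {c} {x} 0<c 0≤cx x<0 = 0≤cx (0<y-x⇒x<y (<-respʳ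
    (solve 2 (λ c x → c :* (:- x) := con (+ 0) :- c :* x) refl c x) (*-pos 0<c (neg-pos x<0))))

  *-cancelˡ-≈0 : ∀ {c x} → 0# < c → c * x ≈ 0# → x ≈ 0#
  *-cancelˡ-≈0 {c} {x} 0<c cx≈0 = antisym
    (≤-by (*-cancelˡ-nonneg 0<c (≤-reflexive (trans (sym -0#≈0#) (trans (-‿cong (sym cx≈0))
        (solve 2 (λ c x → :- (c :* x) := c :* (:- x)) refl c x)))))
      (solve 1 (λ x → :- x := con (+ 0) :- x) refl x))
    (*-cancelˡ-nonneg 0<c (≤-reflexive (sym cx≈0)))
    where open RingProperties ring using (-0#≈0#)

  -- Lets the solver work modulo a hypothesis `z ≈ 0#`: it checks a free identity in which `k` is
  -- the multiplier of that hypothesis.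
  absorb-zero : ∀ {e r k z} → z ≈ 0# → e ≈ r + k * z → e ≈ r
  absorb-zero {e} {r} {k} z≈0 e≈r+kz =
    trans e≈r+kz (trans (+-cong refl (trans (*-cong refl z≈0) (zeroʳ k))) (+-identityʳ r))

  difference-zero : ∀ {x y} → x ≈ y → x - y ≈ 0#
  difference-zero {x} {y} x≈y = trans (+-cong x≈y refl) (-‿inverseʳ y)

  *-/-cancel : ∀ {y} z (0<y : 0# < y) → y * (z / y [ 0<y ]) ≈ z
  *-/-cancel {y} z 0<y = trans
    (solve 3 (λ y z i → y :* (z :* i) := z :* (y :* (:1 :* i))) refl y z _)
    (trans (*-cong refl (/-inverseʳ 0<y)) (*-identityʳ z))

  /-nonneg : ∀ {y z} (0<y : 0# < y) → 0# ≤ z → 0# ≤ z / y [ 0<y ]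
  /-nonneg {z = z} 0<y 0≤z = *-cancelˡ-nonneg 0<y (≤-respʳ (sym (*-/-cancel z 0<y)) 0≤z)

  /-≤ : ∀ {b y z} (0<y : 0# < y) → z ≤ b * y → z / y [ 0<y ] ≤ b
  /-≤ {b} {y} {z} 0<y z≤by = ≤-by
    (*-cancelˡ-nonneg 0<y (nonneg-by (x≤y⇒0≤y-x z≤by)
      (trans (+-cong refl (-‿cong (sym (*-/-cancel z 0<y))))
        (solve 3 (λ b y q → b :* y :- y :* q := y :* (b :- q)) refl b y _)))) refl

  ≤-/ : ∀ {b y z} (0<y : 0# < y) → b * y ≤ z → b ≤ z / y [ 0<y ]
  ≤-/ {b} {y} {z} 0<y by≤z = ≤-by
    (*-cancelˡ-nonneg 0<y (nonneg-by (x≤y⇒0≤y-x by≤z)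
      (trans (+-cong (sym (*-/-cancel z 0<y)) refl)
        (solve 3 (λ b y q → y :* q :- b :* y := y :* (q :- b)) refl b y _)))) refl

  square-≤ : ∀ {c d} → - c ≤ d → d ≤ c → d * d ≤ c * c
  square-≤ {c} {d} -c≤d d≤c = ≤-by (x≤y⇒0≤y-x d≤c ⊗ x≤y⇒0≤y-x -c≤d)
    (solve 2 (λ c d → (c :- d) :* (d :- :- c) := c :* c :- d :* d) refl c d)

  square-≤⇒0≤+ : ∀ {b r} → 0# ≤ r → b * b ≤ r * r → 0# ≤ b + r
  square-≤⇒0≤+ {b} {r} 0≤r bb≤rr b+r<0 = bb≤rr (0<y-x⇒x<y (<-respʳ
    (solve 2 (λ b r → (:- (b :+ r)) :* (:- (b :+ r) :+ :ℕ 2 :* r) := b :* b :- r :* r) refl b r)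
    (*-pos (neg-pos b+r<0) (pos+nonneg (neg-pos b+r<0) (0≤2 ⊗ 0≤r)))))

  fromℕ-+ : ∀ m n → fromℕ (m ℕ.+ n) ≈ fromℕ m + fromℕ n
  fromℕ-+ = ×-homo-+ 1#

  fromℕ-pronic : ∀ n → fromℕ (n ℕ.* (n ℕ.+ 1)) ≈ fromℕ n * (fromℕ n + 1#)
  fromℕ-pronic n = trans (×1-homo-* n (n ℕ.+ 1))
    (*-cong refl (trans (fromℕ-+ n 1) (+-cong refl (+-identityʳ 1#))))

  fromℕ-mono-≤ : ∀ {m n} → m ℕ.≤ n → fromℕ m ≤ fromℕ n
  fromℕ-mono-≤ {m} m≤n with ℕₚ.m≤n⇒∃[o]m+o≡n m≤n
  ... | o , ≡.refl = ≤-by (fromℕ-nonneg o)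
    (trans (solve 2 (λ m o → o := (m :+ o) :- m) refl (fromℕ m) (fromℕ o))
      (+-cong (sym (fromℕ-+ m o)) refl))

  -- Descending from n, cotransitivity offers `k < y` or `y < k + 1` at each k. The alternatives
  -- overlap, so the error is bounded by 1 and not by 1/2. It is squared so as to enter polynomial
  -- identities directly.
  round : ∀ n {y} → 0# ≤ y → y ≤ fromℕ n →
          ∃[ k ] k ℕ.≤ n × (fromℕ k - y) * (fromℕ k - y) ≤ 1#
  round n {y} 0≤y y≤n = go n (≤-<-trans y≤n (0<y-x⇒x<y (<-respʳ
    (solve 1 (λ n → :1 := (:1 :+ n) :- n) refl (fromℕ n)) 0<1)))
    where
    close : ∀ k → fromℕ k < y + 1# → y < fromℕ (suc k) → (fromℕ k - y) * (fromℕ k - y) ≤ 1#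
    close k k<y+1 y<k+1 = ≤-respʳ (*-identityʳ 1#) (square-≤
      (≤-by (x≤y⇒0≤y-x (<⇒≤ y<k+1))
        (solve 2 (λ k y → (:1 :+ k) :- y := (k :- y) :- (:- :1)) refl (fromℕ k) y))
      (≤-by (x≤y⇒0≤y-x (<⇒≤ k<y+1))
        (solve 2 (λ k y → (y :+ :1) :- k := :1 :- (k :- y)) refl (fromℕ k) y)))

    go : ∀ k → y < fromℕ (suc k) → ∃[ j ] j ℕ.≤ k × (fromℕ j - y) * (fromℕ j - y) ≤ 1#
    go zero    y<1 = 0 , z≤n , close 0 (<-respʳ (+-comm 1# y) (pos+nonneg 0<1 0≤y)) y<1
    go (suc k) y<k+2 with <-cotrans (0<y-x⇒x<y (<-respʳ
      (solve 1 (λ k → :1 := (:1 :+ k) :- k) refl (fromℕ k)) 0<1)) y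
    ... | inj₁ k<y   = suc k , ℕₚ.≤-refl ,
      close (suc k) (<-respˡ (+-comm (fromℕ k) 1#) (+-monoˡ-< 1# k<y)) y<k+2
    ... | inj₂ y<k+1 with go k y<k+1
    ...   | j , j≤k , j-close = j , ℕₚ.m≤n⇒m≤1+n j≤k , j-close

  ∣-∣-≤ : ∀ {x y e} → x ≤ y + e → y - e ≤ x → ∣ x - y ∣ ≤ e
  ∣-∣-≤ {x} {y} {e} x≤y+e y-e≤x = ∨-least
    (≤-by (x≤y⇒0≤y-x x≤y+e) (solve 3 (λ x y e → (y :+ e) :- x := e :- (x :- y)) refl x y e))
    (≤-by (x≤y⇒0≤y-x y-e≤x) (solve 3 (λ x y e → x :- (y :- e) := e :- (:- (x :- y))) refl x y e))

  ∣∣-cong : ∀ {x y} → x ≈ y → ∣ x ∣ ≈ ∣ y ∣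
  ∣∣-cong x≈y = antisym (half x≈y) (half (sym x≈y))
    where
    half : ∀ {x y} → x ≈ y → ∣ x ∣ ≤ ∣ y ∣
    half {x} {y} x≈y = ∨-least (≤-respˡ (sym x≈y) (x≤x∨y y (- y)))
      (≤-respˡ (-‿cong (sym x≈y)) (y≤x∨y y (- y)))

  ⟶-resp-≈ : ∀ {s l l′} → l ≈ l′ → s ⟶ l → s ⟶ l′
  ⟶-resp-≈ l≈l′ s⟶l ε 0<ε with s⟶l ε 0<ε
  ... | N , close = N , λ n N≤n → <-respˡ (∣∣-cong (+-cong refl (-‿cong l≈l′))) (close n N≤n)

  half-pos : ∀ {ε} → 0# < ε → 0# < ε / fromℕ 2 [ 0<2 ]
  half-pos 0<ε = /-pos 0<ε 0<2

  half-< : ∀ {ε} → 0# < ε → ε / fromℕ 2 [ 0<2 ] < ε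
  half-< {ε} 0<ε = 0<y-x⇒x<y (<-respʳ
    (trans (solve 1 (λ h → h := :ℕ 2 :* h :- h) refl _) (+-cong (*-/-cancel ε 0<2) refl))
    (half-pos 0<ε))

  open Scheduling R using (maxKinds; minUpTo)

  maxKinds-upper : ∀ {n} (f : Vec Kind n → Carrier) v → f v ≤ maxKinds n f
  maxKinds-upper f []          = ≤-refl
  maxKinds-upper f (short ∷ v) = ≤-trans (maxKinds-upper (λ v → f (short ∷ v)) v) (x≤x∨y _ _)
  maxKinds-upper f (long ∷ v)  = ≤-trans (maxKinds-upper (λ v → f (long ∷ v)) v) (y≤x∨y _ _)

  maxKinds-least : ∀ {n b} (f : Vec Kind n → Carrier) → (∀ v → f v ≤ b) → maxKinds n f ≤ b
  maxKinds-least {zero}  f f≤b = f≤b []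
  maxKinds-least {suc n} f f≤b = ∨-least
    (maxKinds-least (λ v → f (short ∷ v)) (λ v → f≤b (short ∷ v)))
    (maxKinds-least (λ v → f (long ∷ v)) (λ v → f≤b (long ∷ v)))

  minUpTo-lower : ∀ {n a} f → a ℕ.≤ n → minUpTo n f ≤ f a
  minUpTo-lower {zero}  f z≤n = ≤-refl
  minUpTo-lower {suc n} f a≤1+n with ℕₚ.m≤n⇒m<n∨m≡n a≤1+n
  ... | inj₁ (s≤s a≤n) = ≤-trans (x∧y≤x _ _) (minUpTo-lower f a≤n)
  ... | inj₂ ≡.refl    = x∧y≤y _ _

  minUpTo-greatest : ∀ {n b} f → (∀ a → a ℕ.≤ n → b ≤ f a) → b ≤ minUpTo n f
  minUpTo-greatest {zero}  f b≤f = b≤f 0 z≤n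
  minUpTo-greatest {suc n} f b≤f = ∧-greatest
    (minUpTo-greatest f (λ a a≤n → b≤f a (ℕₚ.m≤n⇒m≤1+n a≤n))) (b≤f (suc n) ℕₚ.≤-refl)

-- Exact cost of the most expensive order of jobs.

module Cost {c ℓ₁ ℓ₂} (R : RealField c ℓ₁ ℓ₂) (p x : RealField.Carrier R) where
  open RealField R hiding (zero)
  open RealFieldProperties R
  open IntegerCoefficients commutativeRing
  open OrderedField R
  open Scheduling R using (cost; ALG; OPT)

  -- Twice the cost added by a run on n jobs that starts with k postponed
  -- long jobs and meets l long and t short jobs among the tested ones and
  -- m long jobs among the untested ones, in the order most expensive for
  -- these numbers: long jobs first in either phase.
  worst : Carrier → Carrier → Carrier → Carrier → Carrier → Carrier
  worst n k l t m =
    fromℕ 2 * ((l + t) * (n + k)) - t * (t - 1#)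
    + x * (m * (fromℕ 2 * (n + k - t) - m + 1#) + (k + l) * (k + l + 1#))

  private
    :worst : ∀ {i} → (x n k l t m : Polynomial i) → Polynomial i
    :worst x n k l t m =
      :ℕ 2 :* ((l :+ t) :* (n :+ k)) :- t :* (t :- :1)
      :+ x :* (m :* (:ℕ 2 :* (n :+ k :- t) :- m :+ :1) :+ (k :+ l) :* (k :+ l :+ :1))

    :0 : ∀ {i} → Polynomial i
    :0 = con (+ 0)

    worst-[] : ∀ A k → fromℕ 2 * A + worst 0# (fromℕ k) 0# 0# 0# ≈
               fromℕ 2 * cost p x [] [] A k
    worst-[] A k = sym (trans (distribˡ _ _ _) (trans
      (+-cong refl (trans (*-/-cancel _ 0<2) (*-cong refl (fromℕ-pronic k))))
      (solve 3 (λ x A k → :ℕ 2 :* A :+ x :* (k :* (k :+ :1)) :=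
          :ℕ 2 :* A :+ :worst x :0 k :0 :0 :0)
        refl x A (fromℕ k))))

    -- The surplus `2 x m` is the adversary's doubled loss from running a short job ahead of m
    -- untested long ones: each of them then delays one job fewer.
    worst-E-short : ∀ A n k m →
      fromℕ 2 * A + worst (1# + n) k 0# 0# m ≈
      fromℕ 2 * A + worst n k 0# 0# m + fromℕ 2 * (x * m)
    worst-E-short = solve 5 (λ x A n k m →
      :ℕ 2 :* A :+ :worst x (:1 :+ n) k :0 :0 m :=
      :ℕ 2 :* A :+ :worst x n k :0 :0 m :+ :ℕ 2 :* (x :* m)) refl x

    worst-E-long : ∀ A n k m {r} → r ≈ 1# + n + k →
      fromℕ 2 * A + worst (1# + n) k 0# 0# (1# + m) ≈
      fromℕ 2 * (A + r * x) + worst n k 0# 0# m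
    worst-E-long A n k m r≈ = trans
      (solve 5 (λ x A n k m →
        :ℕ 2 :* A :+ :worst x (:1 :+ n) k :0 :0 (:1 :+ m) :=
        :ℕ 2 :* (A :+ (:1 :+ n :+ k) :* x) :+ :worst x n k :0 :0 m) refl x A n k m)
      (+-cong (*-cong refl (+-cong refl (*-cong (sym r≈) refl))) refl)

    -- The surplus `2 l` is the loss here: each of the l later tests of long jobs delays one job
    -- fewer.
    worst-T-short : ∀ A n k l t m {r} → r ≈ 1# + n + k →
      fromℕ 2 * A + worst (1# + n) k l (1# + t) m ≈
      fromℕ 2 * (A + r) + worst n k l t m + fromℕ 2 * l
    worst-T-short A n k l t m r≈ = trans
      (solve 7 (λ x A n k l t m →
        :ℕ 2 :* A :+ :worst x (:1 :+ n) k l (:1 :+ t) m :=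
        :ℕ 2 :* (A :+ (:1 :+ n :+ k)) :+ :worst x n k l t m :+ :ℕ 2 :* l) refl x A n k l t m)
      (+-cong (+-cong (*-cong refl (+-cong refl (sym r≈))) refl) refl)

    worst-T-long : ∀ A n k l t m {r} → r ≈ 1# + n + k →
      fromℕ 2 * A + worst (1# + n) k (1# + l) t m ≈
      fromℕ 2 * (A + r) + worst n (1# + k) l t m
    worst-T-long A n k l t m r≈ = trans
      (solve 7 (λ x A n k l t m →
        :ℕ 2 :* A :+ :worst x (:1 :+ n) k (:1 :+ l) t m :=
        :ℕ 2 :* (A :+ (:1 :+ n :+ k)) :+ :worst x n (:1 :+ k) l t m) refl x A n k l t m)
      (+-cong (*-cong refl (+-cong refl (sym r≈))) refl)

    fromℕ-≡+ : ∀ {r} m n → r ≡ m ℕ.+ n → fromℕ r ≈ fromℕ m + fromℕ n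
    fromℕ-≡+ m n ≡.refl = fromℕ-+ m n

    weaken : ∀ {y z e} → 0# ≤ e → y ≤ z → y ≤ z + e
    weaken {y} {z} {e} 0≤e y≤z = ≤-trans y≤z
      (≤-by 0≤e (solve 2 (λ z e → e := (z :+ e) :- z) refl z e))

  -- The invariant `r ≡ n + k` says that the unexecuted jobs are the n to come and the k postponed.
  -- A long job at the head matches `worst` exactly; a short one falls behind by a nonnegative
  -- surplus.
  cost-untested-≤ : 0# ≤ x → ∀ {n} k r A (v : Vec Kind n) → r ≡ n ℕ.+ k →
    fromℕ 2 * cost p x (twoPhase 0 n) v A r ≤
    fromℕ 2 * A + worst (fromℕ n) (fromℕ k) 0# 0# (fromℕ (#long v))
  cost-untested-≤ 0≤x k r A []          ≡.refl = ≤-reflexive (sym (worst-[] A k))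
  cost-untested-≤ 0≤x {suc n} k r A (short ∷ v) r≡ = ≤-respʳ
    (sym (worst-E-short A (fromℕ n) (fromℕ k) (fromℕ (#long v))))
    (weaken (0≤2 ⊗ *-fromℕ-nonneg 0≤x (#long v))
      (cost-untested-≤ 0≤x k (pred r) A v (≡.cong pred r≡)))
  cost-untested-≤ 0≤x {suc n} k r A (long ∷ v) r≡ = ≤-respʳ
    (sym (worst-E-long A (fromℕ n) (fromℕ k) (fromℕ (#long v)) (fromℕ-≡+ (suc n) k r≡)))
    (cost-untested-≤ 0≤x k (pred r) (A + fromℕ r * x) v (≡.cong pred r≡))

  cost-≤ : 0# ≤ x → ∀ {n} a k r A (v : Vec Kind n) → a ℕ.≤ n → r ≡ n ℕ.+ k →
    ∃[ l ] ∃[ t ] ∃[ m ] l ℕ.+ t ≡ a × l ℕ.+ m ≡ #long v ×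
    fromℕ 2 * cost p x (twoPhase a n) v A r ≤
    fromℕ 2 * A + worst (fromℕ n) (fromℕ k) (fromℕ l) (fromℕ t) (fromℕ m)
  cost-≤ 0≤x zero k r A v z≤n r≡ =
    0 , 0 , #long v , ≡.refl , ≡.refl , cost-untested-≤ 0≤x k r A v r≡
  cost-≤ 0≤x {suc n} (suc a) k r A (short ∷ v) (s≤s a≤n) r≡
    with cost-≤ 0≤x a k (pred r) (A + fromℕ r) v a≤n (≡.cong pred r≡)
  ... | l , t , m , l+t≡a , l+m≡ , bound =
    l , suc t , m , ≡.trans (ℕₚ.+-suc l t) (≡.cong suc l+t≡a) , l+m≡ , ≤-respʳ
      (sym (worst-T-short A (fromℕ n) (fromℕ k) (fromℕ l) (fromℕ t) (fromℕ m)
        (fromℕ-≡+ (suc n) k r≡)))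
      (weaken (0≤2 ⊗ fromℕ-nonneg l) bound)
  cost-≤ 0≤x {suc n} (suc a) k r A (long ∷ v) (s≤s a≤n) r≡
    with cost-≤ 0≤x a (suc k) r (A + fromℕ r) v a≤n (≡.trans r≡ (≡.sym (ℕₚ.+-suc n k)))
  ... | l , t , m , l+t≡a , l+m≡ , bound =
    suc l , t , m , ≡.cong suc l+t≡a , ≡.cong suc l+m≡ , ≤-respʳ
      (sym (worst-T-long A (fromℕ n) (fromℕ k) (fromℕ l) (fromℕ t) (fromℕ m)
        (fromℕ-≡+ (suc n) k r≡)))
      bound

  -- The four blocks are tested long, tested short, untested long and untested short jobs.
  longFirst : ∀ l t m q → Vec Kind (l ℕ.+ (t ℕ.+ (m ℕ.+ q)))
  longFirst (suc l) t m q = long ∷ longFirst l t m q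
  longFirst zero (suc t) m q = short ∷ longFirst zero t m q
  longFirst zero zero (suc m) q = long ∷ longFirst zero zero m q
  longFirst zero zero zero (suc q) = short ∷ longFirst zero zero zero q
  longFirst zero zero zero zero = []

  #long-longFirst : ∀ l t m q → #long (longFirst l t m q) ≡ l ℕ.+ m
  #long-longFirst (suc l) t m q = ≡.cong suc (#long-longFirst l t m q)
  #long-longFirst zero (suc t) m q = #long-longFirst zero t m q
  #long-longFirst zero zero (suc m) q = ≡.cong suc (#long-longFirst zero zero m q)
  #long-longFirst zero zero zero (suc q) = #long-longFirst zero zero zero q
  #long-longFirst zero zero zero zero = ≡.refl

  -- Equality holds because every surplus is zero: no tested long job remains when the first tested
  -- short one is met, and likewise among the untested.
  cost-longFirst : ∀ l t m q k r A → let n = l ℕ.+ (t ℕ.+ (m ℕ.+ q)) in r ≡ n ℕ.+ k →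
    fromℕ 2 * A + worst (fromℕ n) (fromℕ k) (fromℕ l) (fromℕ t) (fromℕ m) ≈
    fromℕ 2 * cost p x (twoPhase (l ℕ.+ t) n) (longFirst l t m q) A r
  cost-longFirst (suc l) t m q k r A r≡ = trans
    (worst-T-long A (fromℕ n) (fromℕ k) (fromℕ l) (fromℕ t) (fromℕ m) (fromℕ-≡+ (suc n) k r≡))
    (cost-longFirst l t m q (suc k) r (A + fromℕ r) (≡.trans r≡ (≡.sym (ℕₚ.+-suc n k))))
    where n = l ℕ.+ (t ℕ.+ (m ℕ.+ q))
  cost-longFirst zero (suc t) m q k r A r≡ = trans
    (worst-T-short A (fromℕ n) (fromℕ k) 0# (fromℕ t) (fromℕ m) (fromℕ-≡+ (suc n) k r≡))
    (trans (trans (+-cong refl (zeroʳ _)) (+-identityʳ _))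
      (cost-longFirst zero t m q k (pred r) (A + fromℕ r) (≡.cong pred r≡)))
    where n = t ℕ.+ (m ℕ.+ q)
  cost-longFirst zero zero (suc m) q k r A r≡ = trans
    (worst-E-long A (fromℕ n) (fromℕ k) (fromℕ m) (fromℕ-≡+ (suc n) k r≡))
    (cost-longFirst zero zero m q k (pred r) (A + fromℕ r * x) (≡.cong pred r≡))
    where n = m ℕ.+ q
  cost-longFirst zero zero zero (suc q) k r A r≡ = trans
    (worst-E-short A (fromℕ q) (fromℕ k) 0#)
    (trans (solve 2 (λ z x → z :+ :ℕ 2 :* (x :* :0) := z) refl _ x)
      (cost-longFirst zero zero zero q k (pred r) A (≡.cong pred r≡)))
  cost-longFirst zero zero zero zero k r A ≡.refl = worst-[] A k

  -- Twice the optimal cost, as a polynomial in n and the number ℓ of long jobs.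
  opt₂ : Carrier → Carrier → Carrier
  opt₂ n ℓ = p * (n * (n + 1#)) + x * (ℓ * (ℓ + 1#))

  -- 2 (ALG - OPT) for long jobs first in either phase.
  gap : Carrier → Carrier → Carrier → Carrier → Carrier
  gap n l t m = fromℕ 2 * ((l + t) * n) - t * (t - 1#) + fromℕ 2 * (x * (m * (n - (l + t) - m)))

  2*OPT : ∀ {n} (v : Vec Kind n) → fromℕ 2 * OPT p x v ≈ opt₂ (fromℕ n) (fromℕ (#long v))
  2*OPT {n} v = trans (*-/-cancel _ 0<2)
    (+-cong (*-cong refl (fromℕ-pronic n)) (*-cong refl (fromℕ-pronic (#long v))))

  opt₂-cong : ∀ n {ℓ ℓ′} → ℓ ≈ ℓ′ → opt₂ n ℓ ≈ opt₂ n ℓ′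
  opt₂-cong n ℓ≈ℓ′ = +-cong refl (*-cong refl (*-cong ℓ≈ℓ′ (+-cong ℓ≈ℓ′ refl)))

  private
    initial : ∀ n l t m →
      fromℕ 2 * (p * fromℕ (n ℕ.* (n ℕ.+ 1)) / fromℕ 2 [ 0<2 ]) + worst (fromℕ n) 0# l t m ≈
      opt₂ (fromℕ n) (l + m) + gap (fromℕ n) l t m
    initial n l t m = trans
      (+-cong (trans (*-/-cancel _ 0<2) (*-cong refl (fromℕ-pronic n))) refl)
      (solve 6 (λ p x n l t m →
        p :* (n :* (n :+ :1)) :+ :worst x n :0 l t m :=
        (p :* (n :* (n :+ :1)) :+ x :* ((l :+ m) :* (l :+ m :+ :1))) :+
        (:ℕ 2 :* ((l :+ t) :* n) :- t :* (t :- :1)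
          :+ :ℕ 2 :* (x :* (m :* (n :- (l :+ t) :- m)))))
        refl p x (fromℕ n) l t m)

  ALG-≤ : 0# ≤ x → ∀ {n} a (v : Vec Kind n) → a ℕ.≤ n →
    ∃[ l ] ∃[ t ] ∃[ m ] l ℕ.+ t ≡ a × l ℕ.+ m ≡ #long v ×
    fromℕ 2 * ALG p x (twoPhase a n) v ≤
    opt₂ (fromℕ n) (fromℕ (#long v)) + gap (fromℕ n) (fromℕ l) (fromℕ t) (fromℕ m)
  ALG-≤ 0≤x {n} a v a≤n
    with cost-≤ 0≤x a 0 n (p * fromℕ (n ℕ.* (n ℕ.+ 1)) / fromℕ 2 [ 0<2 ]) v a≤n
           (≡.sym (ℕₚ.+-identityʳ n))
  ... | l , t , m , l+t≡a , l+m≡ , bound = l , t , m , l+t≡a , l+m≡ , ≤-respʳ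
    (trans (initial n (fromℕ l) (fromℕ t) (fromℕ m))
      (+-cong (opt₂-cong (fromℕ n) (sym (fromℕ-≡+ l m (≡.sym l+m≡)))) refl))
    bound

  ALG-longFirst : ∀ l t m q → let n = l ℕ.+ (t ℕ.+ (m ℕ.+ q)) in
    opt₂ (fromℕ n) (fromℕ (l ℕ.+ m)) + gap (fromℕ n) (fromℕ l) (fromℕ t) (fromℕ m) ≈
    fromℕ 2 * ALG p x (twoPhase (l ℕ.+ t) n) (longFirst l t m q)
  ALG-longFirst l t m q = trans
    (+-cong (opt₂-cong (fromℕ n) (fromℕ-+ l m)) refl)
    (trans (sym (initial n (fromℕ l) (fromℕ t) (fromℕ m)))
      (cost-longFirst l t m q 0 n _ (≡.sym (ℕₚ.+-identityʳ n))))
    where n = l ℕ.+ (t ℕ.+ (m ℕ.+ q))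

-- From constant bounds on the quadratic part to the limit of the ratios.

module Limit {c ℓ₁ ℓ₂} (R : RealField c ℓ₁ ℓ₂) (p x : RealField.Carrier R) where
  open RealField R hiding (zero)
  open RealFieldProperties R
  open IntegerCoefficients commutativeRing
  open OrderedField R
  open Cost R p x
  open Scheduling R using (ALG; OPT; OPT-pos; maxKinds; ρ)

  -- The quadratic part of 2 (ALG - (1 + s) OPT) when a jobs are tested and
  -- b are not, and the long ones, l and m of them, come first.
  core : Carrier → Carrier → Carrier → Carrier → Carrier → Carrier
  core s a b l m =
    fromℕ 2 * (a * (a + b)) - (a - l) * (a - l) + fromℕ 2 * (x * (m * (b - m)))
    - s * (p * ((a + b) * (a + b))) - s * (x * ((l + m) * (l + m)))

  :core : ∀ {i} → (p x s a b l m : Polynomial i) → Polynomial i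
  :core p x s a b l m =
    :ℕ 2 :* (a :* (a :+ b)) :- (a :- l) :* (a :- l) :+ :ℕ 2 :* (x :* (m :* (b :- m)))
    :- s :* (p :* ((a :+ b) :* (a :+ b))) :- s :* (x :* ((l :+ m) :* (l :+ m)))

  private
    core-cong : ∀ {a a′ b l m} s → a ≈ a′ → core s a b l m ≈ core s a′ b l m
    core-cong s a≈ = +-cong (+-cong (+-cong (+-cong
      (*-cong refl (*-cong a≈ (+-cong a≈ refl)))
      (-‿cong (*-cong (+-cong a≈ refl) (+-cong a≈ refl))))
      refl)
      (-‿cong (*-cong refl (*-cong refl (*-cong (+-cong a≈ refl) (+-cong a≈ refl))))))
      refl

    excess : Carrier → Carrier → Carrier → Carrier → Carrier → Carrier
    excess s n l t m = gap n l t m - s * opt₂ n (l + m)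

    excess-cong : ∀ {n n′ l t m} s → n ≈ n′ → excess s n l t m ≈ excess s n′ l t m
    excess-cong s n≈ = +-cong
      (+-cong (+-cong (*-cong refl (*-cong refl n≈)) refl)
        (*-cong refl (*-cong refl (*-cong refl (+-cong (+-cong n≈ refl) refl)))))
      (-‿cong (*-cong refl (+-cong (*-cong refl (*-cong n≈ (+-cong n≈ refl))) refl)))

    -- Isolates the terms linear in n, l, m and t, which are dropped in the limit.
    excess≈core : ∀ s {n a b l t m} → n ≈ a + b → a ≈ l + t →
      excess s n l t m ≈ core s a b l m + (t - s * p * n - s * x * (l + m))
    excess≈core s {n} {a} {b} {l} {t} {m} n≈ a≈ = trans
      (excess-cong s n≈l+t+b)
      (trans
        (solve 7 (λ p x s l t b m →
          let n = l :+ t :+ b in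
          (:ℕ 2 :* ((l :+ t) :* n) :- t :* (t :- :1)
            :+ :ℕ 2 :* (x :* (m :* (n :- (l :+ t) :- m))))
          :- s :* (p :* (n :* (n :+ :1)) :+ x :* ((l :+ m) :* (l :+ m :+ :1)))
          := :core p x s (l :+ t) b l m :+ (t :- s :* p :* n :- s :* x :* (l :+ m)))
          refl p x s l t b m)
        (+-cong (core-cong s (sym a≈))
          (+-cong (+-cong refl (-‿cong (*-cong refl (sym n≈l+t+b)))) refl)))
      where
      n≈l+t+b : n ≈ l + t + b
      n≈l+t+b = trans n≈ (+-cong a≈ refl)

    halve-≤ : ∀ {b y z} → fromℕ 2 * z ≤ b * (fromℕ 2 * y) → z ≤ b * y
    halve-≤ {b} {y} {z} 2z≤ = ≤-by (*-cancelˡ-nonneg 0<2 (nonneg-by (x≤y⇒0≤y-x 2z≤)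
      (solve 3 (λ b y z → b :* (:ℕ 2 :* y) :- :ℕ 2 :* z := :ℕ 2 :* (b :* y :- z)) refl b y z))) refl

    halve-≥ : ∀ {b y z} → b * (fromℕ 2 * y) ≤ fromℕ 2 * z → b * y ≤ z
    halve-≥ {b} {y} {z} ≤2z = ≤-by (*-cancelˡ-nonneg 0<2 (nonneg-by (x≤y⇒0≤y-x ≤2z)
      (solve 3 (λ b y z → :ℕ 2 :* z :- b :* (:ℕ 2 :* y) := :ℕ 2 :* (z :- b :* y)) refl b y z))) refl

    -- Here `o` stands for 2 OPT, `g` for the gap, `c` for the linear error and `e` for the
    -- tolerance.
    chain-≤ : ∀ {s e o o′ g c y} → y ≤ o + g → g ≤ s * o + c → c ≤ e * o → o′ ≈ o →
      y ≤ (1# + s + e) * o′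
    chain-≤ {s} {e} {o} {o′} {g} {c} y≤ g≤ c≤ o′≈o = ≤-respʳ (*-cong refl (sym o′≈o)) (≤-trans y≤
      (≤-by (x≤y⇒0≤y-x g≤ ⊕ x≤y⇒0≤y-x c≤)
        (solve 5 (λ s e o g c →
          (s :* o :+ c :- g) :+ (e :* o :- c) := (:1 :+ s :+ e) :* o :- (o :+ g))
          refl s e o g c)))

    chain-≥ : ∀ {s e o o′ g c y} → o + g ≈ y → s * o ≤ g + c → c ≤ e * o → o′ ≈ o →
      (1# + s - e) * o′ ≤ y
    chain-≥ {s} {e} {o} {o′} {g} {c} o+g≈y ≤g c≤ o′≈o =
      ≤-respˡ (*-cong refl (sym o′≈o)) (≤-respʳ o+g≈y
        (≤-by (x≤y⇒0≤y-x ≤g ⊕ x≤y⇒0≤y-x c≤)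
          (solve 5 (λ s e o g c →
            (g :+ c :- s :* o) :+ (e :* o :- c) := (o :+ g) :- (:1 :+ s :- e) :* o)
            refl s e o g c)))

  module _ (0<p : 0# < p) (0≤x : 0# ≤ x) (s D E : Carrier)
           (0≤s : 0# ≤ s) (0≤D : 0# ≤ D) (0≤E : 0# ≤ E)
           (upper : ∀ n → ∃[ a ] ∃[ b ] a ℕ.+ b ≡ n ×
             (∀ l m → core s (fromℕ a) (fromℕ b) (fromℕ l) (fromℕ m) ≤ D))
           -- The choice of l and m distinguishes undecidable cases; a double
           -- negation suffices since ≤ is a negation.
           (lower : ∀ a b → ¬ ¬ (∃[ l ] ∃[ m ] l ℕ.≤ a × m ℕ.≤ b ×
             - E ≤ core s (fromℕ a) (fromℕ b) (fromℕ l) (fromℕ m)))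
    where

    private
      -- One coefficient for both directions: `D + 1#` pays for the bound on `core` and for t ≤ n
      -- from above, the rest for `- E` and the negative linear terms from below. As n ≥ 1, the
      -- constants may be multiplied by n.
      C : Carrier
      C = D + 1# + (E + (s * p + s * x))

      0≤p : 0# ≤ p
      0≤p = <⇒≤ 0<p

      0≤1 : 0# ≤ 1#
      0≤1 = <⇒≤ 0<1

      1≤fromℕ : ∀ n .{{_ : NonZero n}} → 1# ≤ fromℕ n
      1≤fromℕ (suc n) = ≤-by (fromℕ-nonneg n) (solve 1 (λ n → n := (:1 :+ n) :- :1) refl (fromℕ n))

      gap-≤ : ∀ n .{{_ : NonZero n}} → ∃[ a ] a ℕ.≤ n × (∀ l t m → l ℕ.+ t ≡ a →
        gap (fromℕ n) (fromℕ l) (fromℕ t) (fromℕ m) ≤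
        s * opt₂ (fromℕ n) (fromℕ l + fromℕ m) + C * fromℕ n)
      gap-≤ n with upper n
      ... | a , b , ≡.refl , core≤D = a , ℕₚ.m≤m+n a b , λ { l t m ≡.refl → ≤-by
        (x≤y⇒0≤y-x (core≤D l m)
          ⊕ 0≤D ⊗ x≤y⇒0≤y-x (1≤fromℕ n)
          ⊕ x≤y⇒0≤y-x (fromℕ-mono-≤ {t} {n} (ℕₚ.≤-trans (ℕₚ.m≤n+m t l) (ℕₚ.m≤m+n (l ℕ.+ t) b)))
          ⊕ (0≤E ⊕ (0≤s ⊗ 0≤p ⊕ 0≤s ⊗ 0≤x)) ⊗ fromℕ-nonneg n
          ⊕ 0≤s ⊗ 0≤p ⊗ fromℕ-nonneg n
          ⊕ 0≤s ⊗ 0≤x ⊗ (fromℕ-nonneg l ⊕ fromℕ-nonneg m))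
        (absorb-zero
          (difference-zero (excess≈core s (fromℕ-+ (l ℕ.+ t) b) (fromℕ-+ l t)))
          (solve 12 (λ p x s D E n l t m g o c →
            (D :- c) :+ D :* (n :- :1) :+ (n :- t) :+ (E :+ (s :* p :+ s :* x)) :* n
              :+ s :* p :* n :+ s :* x :* (l :+ m)
            := (s :* o :+ (D :+ :1 :+ (E :+ (s :* p :+ s :* x))) :* n :- g)
               :+ :1 :* ((g :- s :* o) :- (c :+ (t :- s :* p :* n :- s :* x :* (l :+ m)))))
            refl p x s D E (fromℕ n) (fromℕ l) (fromℕ t) (fromℕ m) _ _ _)) }

      gap-≥ : ∀ n .{{_ : NonZero n}} a → a ℕ.≤ n →
        ¬ ¬ (∃[ l ] ∃[ t ] ∃[ m ] ∃[ q ] l ℕ.+ t ≡ a × n ≡ l ℕ.+ (t ℕ.+ (m ℕ.+ q)) ×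
        s * opt₂ (fromℕ n) (fromℕ l + fromℕ m) ≤
        gap (fromℕ n) (fromℕ l) (fromℕ t) (fromℕ m) + C * fromℕ n)
      gap-≥ n a a≤n k with ℕₚ.m≤n⇒∃[o]m+o≡n a≤n
      ... | b , ≡.refl = lower a b
        (λ (l , m , l≤a , m≤b , -E≤core) → k (claim l m l≤a m≤b -E≤core))
        where
        claim : ∀ l m → l ℕ.≤ a → m ℕ.≤ b →
          - E ≤ core s (fromℕ a) (fromℕ b) (fromℕ l) (fromℕ m) →
          ∃[ l ] ∃[ t ] ∃[ m ] ∃[ q ] l ℕ.+ t ≡ a × n ≡ l ℕ.+ (t ℕ.+ (m ℕ.+ q)) ×
          s * opt₂ (fromℕ n) (fromℕ l + fromℕ m) ≤
          gap (fromℕ n) (fromℕ l) (fromℕ t) (fromℕ m) + C * fromℕ n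
        claim l m l≤a m≤b -E≤core with ℕₚ.m≤n⇒∃[o]m+o≡n l≤a | ℕₚ.m≤n⇒∃[o]m+o≡n m≤b
        ... | t , ≡.refl | q , ≡.refl = l , t , m , q , ≡.refl , ℕₚ.+-assoc l t (m ℕ.+ q) , ≤-by
          (x≤y⇒0≤y-x -E≤core
            ⊕ 0≤E ⊗ x≤y⇒0≤y-x (1≤fromℕ n)
            ⊕ fromℕ-nonneg t
            ⊕ (0≤D ⊕ 0≤1) ⊗ fromℕ-nonneg n
            ⊕ 0≤s ⊗ 0≤x ⊗ nonneg-by (x≤y⇒0≤y-x (fromℕ-mono-≤ {l ℕ.+ m} {n} (ℕₚ.+-mono-≤ l≤a m≤b)))
                (+-cong refl (-‿cong (fromℕ-+ l m))))
          (absorb-zero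
            (difference-zero (excess≈core s (fromℕ-+ (l ℕ.+ t) b) (fromℕ-+ l t)))
            (solve 12 (λ p x s D E n l t m g o c →
              (c :- (:- E)) :+ E :* (n :- :1) :+ t :+ (D :+ :1) :* n
                :+ s :* x :* (n :- (l :+ m))
              := (g :+ (D :+ :1 :+ (E :+ (s :* p :+ s :* x))) :* n :- s :* o)
                 :+ (:- :1) :* ((g :- s :* o) :- (c :+ (t :- s :* p :* n :- s :* x :* (l :+ m)))))
              refl p x s D E (fromℕ n) (fromℕ l) (fromℕ t) (fromℕ m) _ _ _))

      module _ (e : Carrier) (0<e : 0# < e) where
        q : Carrier
        q = p * e

        0<q : 0# < q
        0<q = *-pos 0<p 0<e

        N : ℕ
        N = proj₁ (archimedean (C / q [ 0<q ]))

        -- `opt₂` is at least p n², so a linear error is within the tolerance once n exceeds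
        -- `C / (p e)`, which `N` does.
        C*n≤e*opt₂ : ∀ {n ℓ} → N ℕ.≤ n → 0# ≤ ℓ → C * fromℕ n ≤ e * opt₂ (fromℕ n) ℓ
        C*n≤e*opt₂ {n} {ℓ} N≤n 0≤ℓ = ≤-by
          (<⇒≤ 0<e ⊗ (0≤p ⊗ fromℕ-nonneg n ⊕ 0≤x ⊗ (0≤ℓ ⊗ (0≤ℓ ⊕ 0≤1)))
            ⊕ fromℕ-nonneg n ⊗ (<⇒≤ 0<q ⊗ x≤y⇒0≤y-x (fromℕ-mono-≤ N≤n)
              ⊕ <⇒≤ 0<q ⊗ x≤y⇒0≤y-x (<⇒≤ (proj₂ (archimedean (C / q [ 0<q ]))))))
          (absorb-zero (difference-zero (*-/-cancel C 0<q))
            (solve 8 (λ p x e n ℓ k u C →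
              e :* (p :* n :+ x :* (ℓ :* (ℓ :+ :1)))
                :+ n :* (p :* e :* (n :- k) :+ p :* e :* (k :- u))
              := (e :* (p :* (n :* (n :+ :1)) :+ x :* (ℓ :* (ℓ :+ :1))) :- C :* n)
                 :+ (:- n) :* (p :* e :* u :- C))
              refl p x e (fromℕ n) ℓ (fromℕ N) _ C))

        ratio : ∀ {n} .{{_ : NonZero n}} → ℕ → Vec Kind n → Carrier
        ratio {n} a v = ALG p x (twoPhase a n) v / OPT p x v [ OPT-pos p x 0<p 0≤x v ]

        ratio-≤ : ∀ {n} .{{_ : NonZero n}} → N ℕ.≤ n → ∀ a → a ℕ.≤ n →
          (∀ l t m → l ℕ.+ t ≡ a → gap (fromℕ n) (fromℕ l) (fromℕ t) (fromℕ m) ≤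
            s * opt₂ (fromℕ n) (fromℕ l + fromℕ m) + C * fromℕ n) →
          (v : Vec Kind n) → ratio a v ≤ 1# + s + e
        ratio-≤ {n} N≤n a a≤n gap≤ v =
          let l , t , m , l+t≡a , l+m≡ , bound = ALG-≤ 0≤x a v a≤n
              l+m≈ : fromℕ l + fromℕ m ≈ fromℕ (#long v)
              l+m≈ = trans (sym (fromℕ-+ l m)) (reflexive (≡.cong fromℕ l+m≡))
          in /-≤ {1# + s + e} {OPT p x v} {ALG p x (twoPhase a n) v} (OPT-pos p x 0<p 0≤x v)
            (halve-≤ {1# + s + e} {OPT p x v} {ALG p x (twoPhase a n) v}
              (chain-≤ bound
                (≤-respʳ (+-cong (*-cong refl (opt₂-cong (fromℕ n) l+m≈)) refl) (gap≤ l t m l+t≡a))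
                (C*n≤e*opt₂ N≤n (fromℕ-nonneg (#long v)))
                (2*OPT v)))

        ρ-≤ : ∀ n .{{_ : NonZero n}} → N ℕ.≤ n → ρ p x 0<p 0≤x n ≤ 1# + s + e
        ρ-≤ n N≤n =
          let a , a≤n , gap≤ = gap-≤ n in
          ≤-trans (minUpTo-lower (λ a → maxKinds n (ratio a)) a≤n)
            (maxKinds-least (ratio a) (ratio-≤ N≤n a a≤n gap≤))

        ≤-ratio : ∀ {n} .{{_ : NonZero n}} → N ℕ.≤ n → ∀ a l t m q →
          l ℕ.+ t ≡ a → n ≡ l ℕ.+ (t ℕ.+ (m ℕ.+ q)) →
          s * opt₂ (fromℕ n) (fromℕ l + fromℕ m) ≤
            gap (fromℕ n) (fromℕ l) (fromℕ t) (fromℕ m) + C * fromℕ n →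
          ∃[ v ] 1# + s - e ≤ ratio a v
        ≤-ratio {n} N≤n a l t m q ≡.refl ≡.refl gap≥ = v ,
          ≤-/ {1# + s - e} {OPT p x v} {ALG p x (twoPhase a n) v} (OPT-pos p x 0<p 0≤x v)
            (halve-≥ {1# + s - e} {OPT p x v} {ALG p x (twoPhase a n) v}
              (chain-≥ (ALG-longFirst l t m q)
                (≤-respˡ (*-cong refl (opt₂-cong (fromℕ n) (sym (fromℕ-+ l m)))) gap≥)
                (C*n≤e*opt₂ N≤n (fromℕ-nonneg (l ℕ.+ m)))
                (trans (2*OPT v)
                  (opt₂-cong (fromℕ n) (reflexive (≡.cong fromℕ (#long-longFirst l t m q)))))))
          where
          v : Vec Kind n
          v = longFirst l t m q

        ρ-≥ : ∀ n .{{_ : NonZero n}} → N ℕ.≤ n → 1# + s - e ≤ ρ p x 0<p 0≤x n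
        ρ-≥ n N≤n = minUpTo-greatest (λ a → maxKinds n (ratio a)) λ a a≤n max< →
          gap-≥ n a a≤n (λ (l , t , m , q , l+t≡a , n≡ , gap≥) →
            let v , bound = ≤-ratio N≤n a l t m q l+t≡a n≡ gap≥
            in ≤-trans bound (maxKinds-upper (ratio a) v) max<)

    ρ⟶1+s : (λ m → ρ p x 0<p 0≤x (suc m)) ⟶ 1# + s
    ρ⟶1+s ε 0<ε = N e 0<e , λ n N≤n → ≤-<-trans
      (∣-∣-≤ (ρ-≤ e 0<e (suc n) (ℕₚ.m≤n⇒m≤1+n N≤n)) (ρ-≥ e 0<e (suc n) (ℕₚ.m≤n⇒m≤1+n N≤n)))
      (half-< 0<ε)
      where
      e : Carrier
      -- Halving turns the non-strict bounds on `ρ` into the strict one that convergence demands.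
      e = ε / fromℕ 2 [ 0<2 ]

      0<e : 0# < e
      0<e = half-pos 0<ε

-- Rounding real optima to admissible counts.

module Rounding {c ℓ₁ ℓ₂} (R : RealField c ℓ₁ ℓ₂) where
  open RealField R hiding (zero)
  open RealFieldProperties R
  open IntegerCoefficients commutativeRing
  open OrderedField R

  -- The integer k approximates z / c; multiplying the error by c keeps division out of the later
  -- identities.
  round-quotient : ∀ n {c z} → 0# < c → 0# ≤ z → z ≤ c * fromℕ n →
    ∃[ k ] k ℕ.≤ n × (c * fromℕ k - z) * (c * fromℕ k - z) ≤ c * c
  round-quotient n {c} {z} 0<c 0≤z z≤cn = k , k≤n , ≤-by
    (<⇒≤ 0<c ⊗ <⇒≤ 0<c ⊗ x≤y⇒0≤y-x close)
    (trans (solve 3 (λ c y k → c :* c :* (:1 :- (k :- y) :* (k :- y)) :=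
        c :* c :- (c :* k :- c :* y) :* (c :* k :- c :* y)) refl c y (fromℕ k))
      (+-cong refl (-‿cong (*-cong ck-cy≈ ck-cy≈))))
    where
    y : Carrier
    y = z / c [ 0<c ]

    cy≈z : c * y ≈ z
    cy≈z = *-/-cancel z 0<c

    rounded : ∃[ k ] k ℕ.≤ n × (fromℕ k - y) * (fromℕ k - y) ≤ 1#
    rounded = round n (/-nonneg 0<c 0≤z) (/-≤ 0<c (≤-respʳ (*-comm c (fromℕ n)) z≤cn))

    k : ℕ
    k = proj₁ rounded

    k≤n : k ℕ.≤ n
    k≤n = proj₁ (proj₂ rounded)

    close : (fromℕ k - y) * (fromℕ k - y) ≤ 1#
    close = proj₂ (proj₂ rounded)

    ck-cy≈ : c * fromℕ k - c * y ≈ c * fromℕ k - z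
    ck-cy≈ = +-cong refl (-‿cong cy≈z)

-- Small x: the optimum tests no job.

module NoTests {c ℓ₁ ℓ₂} (R : RealField c ℓ₁ ℓ₂) (p x s : RealField.Carrier R) where
  open RealField R hiding (zero)
  open RealFieldProperties R
  open IntegerCoefficients commutativeRing
  open OrderedField R
  open Rounding R
  open Limit R p x
  open Scheduling R using (ρ)

  -- For a = l = 0 the real maximiser of `core` is m = b / w.
  w : Carrier
  w = fromℕ 2 + s

  module _ (0<p : 0# < p) (0≤x : 0# ≤ x) (0≤s : 0# ≤ s) (sp≤1 : s * p ≤ 1#)
           (x≈psw : x ≈ p * s * w) where

    private
      0≤p : 0# ≤ p
      0≤p = <⇒≤ 0<p

      0<w : 0# < w
      0<w = pos+nonneg 0<2 0≤s

      -- At a = 0 the equation for s turns `core` into minus the square of b - w m, weighted by p s,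
      -- minus terms in l that are nonnegative.
      upper : ∀ n → ∃[ a ] ∃[ b ] a ℕ.+ b ≡ n ×
        (∀ l m → core s (fromℕ a) (fromℕ b) (fromℕ l) (fromℕ m) ≤ 0#)
      upper n = 0 , n , ≡.refl , λ l m → ≤-by
        (0≤p ⊗ 0≤s ⊗ square-nonneg (fromℕ n - w * fromℕ m)
          ⊕ square-nonneg (fromℕ l)
          ⊕ 0≤s ⊗ 0≤x ⊗ (square-nonneg (fromℕ l) ⊕ 0≤2 ⊗ (fromℕ-nonneg l ⊗ fromℕ-nonneg m)))
        (absorb-zero (difference-zero x≈psw)
          (solve 6 (λ p x s b l m →
            let w = :ℕ 2 :+ s; :0 = con (+ 0) in
            p :* s :* ((b :- w :* m) :* (b :- w :* m)) :+ l :* l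
              :+ s :* x :* (l :* l :+ :ℕ 2 :* (l :* m))
            := (:0 :- :core p x s :0 b l m)
               :+ (:ℕ 2 :* (b :* m) :- w :* (m :* m)) :* (x :- p :* s :* w))
            refl p x s (fromℕ n) (fromℕ l) (fromℕ m)))

      -- The adversary ignores the tests: l = 0 and m near b / w. Tests then contribute (1 - s p)(a²
      -- + 2ab) ≥ 0, and only the rounding of m costs anything.
      lower : ∀ a b → ¬ ¬ (∃[ l ] ∃[ m ] l ℕ.≤ a × m ℕ.≤ b ×
        - (p * s * (w * w)) ≤ core s (fromℕ a) (fromℕ b) (fromℕ l) (fromℕ m))
      lower a b k =
        let m , m≤b , close = round-quotient b 0<w (fromℕ-nonneg b) (≤-by
              (fromℕ-nonneg b ⊗ (<⇒≤ 0<1 ⊕ 0≤s))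
              (solve 2 (λ s b → b :* (:1 :+ s) := (:ℕ 2 :+ s) :* b :- b) refl s (fromℕ b)))
        in k (0 , m , z≤n , m≤b , ≤-by
          ((square-nonneg (fromℕ a) ⊕ 0≤2 ⊗ (fromℕ-nonneg a ⊗ fromℕ-nonneg b)) ⊗ x≤y⇒0≤y-x sp≤1
            ⊕ 0≤p ⊗ 0≤s ⊗ x≤y⇒0≤y-x close)
          (absorb-zero (difference-zero x≈psw)
            (solve 6 (λ p x s a b m →
              let w = :ℕ 2 :+ s in
              (a :* a :+ :ℕ 2 :* (a :* b)) :* (:1 :- s :* p)
                :+ p :* s :* (w :* w :- (w :* m :- b) :* (w :* m :- b))
              := (:core p x s a b (con (+ 0)) m :- (:- (p :* s :* (w :* w))))
                 :+ (w :* (m :* m) :- :ℕ 2 :* (b :* m)) :* (x :- p :* s :* w))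
              refl p x s (fromℕ a) (fromℕ b) (fromℕ m))))

    ρ⟶ : (λ m → ρ p x 0<p 0≤x (suc m)) ⟶ 1# + s
    ρ⟶ = ρ⟶1+s 0<p 0≤x s 0# (p * s * (w * w)) 0≤s ≤-refl
      (0≤p ⊗ 0≤s ⊗ square-nonneg w) upper lower

-- Large x: the optimum tests a positive share of the jobs.

module CompletedSquare {c ℓ₁ ℓ₂} (R : RealField c ℓ₁ ℓ₂) where
  open RealField R hiding (zero)
  open RealFieldProperties R
  open IntegerCoefficients commutativeRing
  open OrderedField R

  -- To be read with `y` as `core`, `r` as the squared distance of b from its optimum and `δ` as the
  -- adversary's deviation from the real maximiser, both scaled.
  module _ {K Q y r δ : Carrier} (0<K : 0# < K) (0<Q : 0# < Q)
           (completed : fromℕ 4 * K * K * Q * y ≈ fromℕ 4 * K * r - Q * δ) where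

    private
      0<4KKQ : 0# < fromℕ 4 * K * K * Q
      0<4KKQ = *-pos (*-pos (*-pos (fromℕ-pos 4) 0<K) 0<K) 0<Q

    completed-≤ : 1# ≤ K → r ≤ Q * Q → 0# ≤ δ → y ≤ Q
    completed-≤ 1≤K r≤QQ 0≤δ = ≤-by (*-cancelˡ-nonneg 0<4KKQ (nonneg-by
      (fromℕ-nonneg 4 ⊗ <⇒≤ 0<K ⊗ (x≤y⇒0≤y-x 1≤K ⊗ square-nonneg Q ⊕ x≤y⇒0≤y-x r≤QQ)
        ⊕ <⇒≤ 0<Q ⊗ 0≤δ)
      (absorb-zero (difference-zero completed)
        (solve 5 (λ K Q y r δ →
          :ℕ 4 :* K :* ((K :- :1) :* (Q :* Q) :+ (Q :* Q :- r)) :+ Q :* δ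
          := :ℕ 4 :* K :* K :* Q :* (Q :- y)
             :+ :1 :* (:ℕ 4 :* K :* K :* Q :* y :- (:ℕ 4 :* K :* r :- Q :* δ)))
          refl K Q y r δ)))) refl

    completed-≥ : ∀ {g} → 0# ≤ r → δ ≤ fromℕ 4 * g * (K * K) → - g ≤ y
    completed-≥ {g} 0≤r δ≤ = ≤-by (*-cancelˡ-nonneg 0<4KKQ (nonneg-by
      (fromℕ-nonneg 4 ⊗ <⇒≤ 0<K ⊗ 0≤r ⊕ <⇒≤ 0<Q ⊗ x≤y⇒0≤y-x δ≤)
      (absorb-zero (difference-zero completed)
        (solve 6 (λ K Q y r δ g →
          :ℕ 4 :* K :* r :+ Q :* (:ℕ 4 :* g :* (K :* K) :- δ)
          := :ℕ 4 :* K :* K :* Q :* (y :- (:- g))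
             :+ (:- :1) :* (:ℕ 4 :* K :* K :* Q :* y :- (:ℕ 4 :* K :* r :- Q :* δ)))
          refl K Q y r δ g)))) refl

  rounding-loss : ∀ {c k y r} → 0# < c → 0# ≤ k → 0# ≤ c * y + k * r → r ≤ c * c → - (k * c) ≤ y
  rounding-loss {c} {k} {y} {r} 0<c 0≤k 0≤rest r≤cc = ≤-by
    (*-cancelˡ-nonneg 0<c (nonneg-by (0≤rest ⊕ 0≤k ⊗ x≤y⇒0≤y-x r≤cc)
      (solve 4 (λ c k y r → (c :* y :+ k :* r) :+ k :* (c :* c :- r) := c :* (y :- (:- (k :* c))))
        refl c k y r))) refl

module SomeTests {c ℓ₁ ℓ₂} (R : RealField c ℓ₁ ℓ₂) (p x s : RealField.Carrier R) where
  open RealField R hiding (zero)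
  open RealFieldProperties R
  open IntegerCoefficients commutativeRing
  open OrderedField R
  open Rounding R
  open CompletedSquare R
  open Limit R p x
  open Scheduling R using (ρ)

  -- The maximiser has l + m = (2a + b) / K, and the optimal share of untested jobs is V / Q. With n
  -- = a + b, the scaled coordinates `Y` and `Z` below equal W n - V b and 2 (D b - s n), so V and D
  -- locate where the maximiser leaves the box.
  K W V C D Q : Carrier
  K = fromℕ 2 + fromℕ 2 * (s * x) + s
  W = fromℕ 2 + s
  V = fromℕ 2 + s + s * x
  C = 1# + s * x
  D = 1# + s + s * x
  Q = x * (1# + s * x)

  private
    :K :W :V :C :D :Q : ∀ {i} → (s x : Polynomial i) → Polynomial i
    :K s x = :ℕ 2 :+ :ℕ 2 :* (s :* x) :+ s
    :W s x = :ℕ 2 :+ s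
    :V s x = :ℕ 2 :+ s :+ s :* x
    :C s x = :1 :+ s :* x
    :D s x = :1 :+ s :+ s :* x
    :Q s x = x :* (:1 :+ s :* x)

    :0 : ∀ {i} → Polynomial i
    :0 = con (+ 0)

    :sq : ∀ {i} → Polynomial i → Polynomial i
    :sq y = y :* y

  -- `spQ≈` is the quadratic equation for s, grouped as the coefficient of (a + b)² that must vanish
  -- in `complete-square`.
  module _ (0<p : 0# < p) (0≤s : 0# ≤ s) (W≤x : W ≤ x)
           (spQ≈ : V * (x - 1#) ≈ s * (p * Q)) where

    private
      0≤1 : 0# ≤ 1#
      0≤1 = <⇒≤ 0<1

      0<W : 0# < W
      0<W = pos+nonneg 0<2 0≤s

      0<x : 0# < x
      0<x = <-≤-trans 0<W W≤x

      0≤x : 0# ≤ x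
      0≤x = <⇒≤ 0<x

      0≤sx : 0# ≤ s * x
      0≤sx = 0≤s ⊗ 0≤x

      0<K : 0# < K
      0<K = pos+nonneg (pos+nonneg 0<2 (0≤2 ⊗ 0≤sx)) 0≤s

      0<V : 0# < V
      0<V = pos+nonneg 0<W 0≤sx

      0<C : 0# < C
      0<C = pos+nonneg 0<1 0≤sx

      0<D : 0# < D
      0<D = pos+nonneg (pos+nonneg 0<1 0≤s) 0≤sx

      0<Q : 0# < Q
      0<Q = *-pos 0<x 0<C

      -- K l* and 2 K m* for the maximiser (l*, m*) of core over all real l and m.
      Y Z : Carrier → Carrier → Carrier
      Y a b = a * W - s * x * b
      Z a b = b * K - s * (fromℕ 2 * a + b)

      :Y :Z : ∀ {i} → (s x a b : Polynomial i) → Polynomial i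
      :Y s x a b = a :* :W s x :- s :* x :* b
      :Z s x a b = b :* :K s x :- s :* (:ℕ 2 :* a :+ b)

      -- 4 K² times the negated second-order part of `core` in (l, m), at displacement (u / K, v /
      -- 2K) from the maximiser.
      deviation : Carrier → Carrier → Carrier
      deviation u v =
        fromℕ 4 * (u * u) + fromℕ 2 * (x * (v * v)) + s * (x * ((fromℕ 2 * u + v) * (fromℕ 2 * u + v)))

      -- spQ≈ makes the maximum of core proportional to a perfect square in a and b.
      complete-square : ∀ a b l m →
        fromℕ 4 * K * K * Q * core s a b l m ≈
        fromℕ 4 * K * ((Q * b - V * (a + b)) * (Q * b - V * (a + b)))
        - Q * deviation (K * l - Y a b) (fromℕ 2 * K * m - Z a b)
      complete-square a b l m = absorb-zero (difference-zero spQ≈)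
        (solve 7 (λ p x s a b l m →
          let K = :K s x; Q = :Q s x; V = :V s x
              u = K :* l :- :Y s x a b; v = :ℕ 2 :* K :* m :- :Z s x a b in
          :ℕ 4 :* K :* K :* Q :* :core p x s a b l m :=
          :ℕ 4 :* K :* :sq (Q :* b :- V :* (a :+ b))
            :- Q :* (:ℕ 4 :* :sq u :+ :ℕ 2 :* (x :* :sq v) :+ s :* (x :* :sq (:ℕ 2 :* u :+ v)))
          :+ :ℕ 4 :* K :* K :* :sq (a :+ b) :* (V :* (x :- :1) :- s :* (p :* Q)))
          refl p x s a b l m)

      deviation-nonneg : ∀ u v → 0# ≤ deviation u v
      deviation-nonneg u v = fromℕ-nonneg 4 ⊗ square-nonneg u ⊕ 0≤2 ⊗ (0≤x ⊗ square-nonneg v)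
        ⊕ 0≤s ⊗ (0≤x ⊗ square-nonneg (fromℕ 2 * u + v))

      -- The mixed square is at most 8u² + 2v², the defect being (2u - v)².
      deviation-≤ : ∀ {u v} → u * u ≤ K * K → v * v ≤ fromℕ 2 * K * (fromℕ 2 * K) →
        deviation u v ≤ fromℕ 4 * (1# + fromℕ 2 * x + fromℕ 4 * (s * x)) * (K * K)
      deviation-≤ {u} {v} uu≤ vv≤ = ≤-by
        (fromℕ-nonneg 4 ⊗ x≤y⇒0≤y-x uu≤ ⊕ 0≤2 ⊗ (0≤x ⊗ x≤y⇒0≤y-x vv≤)
          ⊕ 0≤s ⊗ (0≤x ⊗ (fromℕ-nonneg 8 ⊗ x≤y⇒0≤y-x uu≤ ⊕ 0≤2 ⊗ x≤y⇒0≤y-x vv≤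
              ⊕ square-nonneg (fromℕ 2 * u - v))))
        (solve 5 (λ x s u v K →
          :ℕ 4 :* (K :* K :- u :* u) :+ :ℕ 2 :* (x :* (:ℕ 2 :* K :* (:ℕ 2 :* K) :- v :* v))
          :+ s :* (x :* (:ℕ 8 :* (K :* K :- u :* u)
              :+ :ℕ 2 :* (:ℕ 2 :* K :* (:ℕ 2 :* K) :- v :* v) :+ :sq (:ℕ 2 :* u :- v)))
          := :ℕ 4 :* (:1 :+ :ℕ 2 :* x :+ :ℕ 4 :* (s :* x)) :* (K :* K)
             :- (:ℕ 4 :* (u :* u) :+ :ℕ 2 :* (x :* (v :* v))
               :+ s :* (x :* :sq (:ℕ 2 :* u :+ v))))
          refl x s u v K)

      1≤x : 1# ≤ x
      1≤x = ≤-trans (≤-by (0≤1 ⊕ 0≤s) (solve 1 (λ s → :1 :+ s := (:ℕ 2 :+ s) :- :1) refl s)) W≤x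

      1≤K : 1# ≤ K
      1≤K = ≤-by (0≤1 ⊕ 0≤2 ⊗ 0≤sx ⊕ 0≤s)
        (solve 2 (λ s x → :1 :+ :ℕ 2 :* (s :* x) :+ s := :K s x :- :1) refl s x)

      -- Ensures that the optimal number V n / Q of untested jobs does not exceed n.
      V≤Q : V ≤ Q
      V≤Q = ≤-by (x≤y⇒0≤y-x W≤x ⊕ 0≤sx ⊗ x≤y⇒0≤y-x 1≤x)
        (solve 2 (λ s x → (x :- :W s x) :+ s :* x :* (x :- :1) := :Q s x :- :V s x) refl s x)

      core-≤ : ∀ a b l m →
        (Q * fromℕ b - V * (fromℕ a + fromℕ b)) * (Q * fromℕ b - V * (fromℕ a + fromℕ b)) ≤ Q * Q →
        core s (fromℕ a) (fromℕ b) (fromℕ l) (fromℕ m) ≤ Q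
      core-≤ a b l m close =
        completed-≤ 0<K 0<Q (complete-square (fromℕ a) (fromℕ b) (fromℕ l) (fromℕ m)) 1≤K close
          (deviation-nonneg (K * fromℕ l - Y (fromℕ a) (fromℕ b))
            (fromℕ 2 * K * fromℕ m - Z (fromℕ a) (fromℕ b)))

      upper : ∀ n → ∃[ a ] ∃[ b ] a ℕ.+ b ≡ n ×
        (∀ l m → core s (fromℕ a) (fromℕ b) (fromℕ l) (fromℕ m) ≤ Q)
      upper n =
        let b , b≤n , close = round-quotient n 0<Q (<⇒≤ 0<V ⊗ fromℕ-nonneg n) (≤-by
              (x≤y⇒0≤y-x V≤Q ⊗ fromℕ-nonneg n)
              (solve 3 (λ Q V n → (Q :- V) :* n := Q :* n :- V :* n) refl Q V (fromℕ n)))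
        in n ℕ.∸ b , b , ℕₚ.m∸n+n≡m b≤n , λ l m →
          core-≤ (n ℕ.∸ b) b l m (≤-respˡ (Qb-Vn≈ b b≤n) close)
        where
        Qb-Vn≈ : ∀ b → b ℕ.≤ n →
          (Q * fromℕ b - V * fromℕ n) * (Q * fromℕ b - V * fromℕ n) ≈
          (Q * fromℕ b - V * (fromℕ (n ℕ.∸ b) + fromℕ b)) *
          (Q * fromℕ b - V * (fromℕ (n ℕ.∸ b) + fromℕ b))
        Qb-Vn≈ b b≤n = *-cong factor factor
          where
          factor : Q * fromℕ b - V * fromℕ n ≈ Q * fromℕ b - V * (fromℕ (n ℕ.∸ b) + fromℕ b)
          factor = +-cong refl (-‿cong (*-cong refl
            (trans (reflexive (≡.cong fromℕ (≡.sym (ℕₚ.m∸n+n≡m b≤n)))) (fromℕ-+ (n ℕ.∸ b) b))))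

      -- The real maximiser always satisfies l ≤ a and m ≤ b, so only the signs of `Y` and `Z` have
      -- to be assumed.
      lower-interior : ∀ a b → 0# ≤ Y (fromℕ a) (fromℕ b) → 0# ≤ Z (fromℕ a) (fromℕ b) →
        ∃[ l ] ∃[ m ] l ℕ.≤ a × m ℕ.≤ b ×
        - (1# + fromℕ 2 * x + fromℕ 4 * (s * x)) ≤
          core s (fromℕ a) (fromℕ b) (fromℕ l) (fromℕ m)
      lower-interior a b 0≤Y 0≤Z =
        let l , l≤a , closeₗ = round-quotient a 0<K 0≤Y (≤-by
               (0≤sx ⊗ (0≤2 ⊗ fromℕ-nonneg a ⊕ fromℕ-nonneg b))
               (solve 4 (λ s x a b → s :* x :* (:ℕ 2 :* a :+ b) := :K s x :* a :- :Y s x a b)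
                 refl s x (fromℕ a) (fromℕ b)))
            m , m≤b , closeₘ = round-quotient b (*-pos 0<2 0<K) 0≤Z (≤-by
               (fromℕ-nonneg b ⊗ <⇒≤ 0<K ⊕ 0≤s ⊗ (0≤2 ⊗ fromℕ-nonneg a ⊕ fromℕ-nonneg b))
               (solve 4 (λ s x a b → b :* :K s x :+ s :* (:ℕ 2 :* a :+ b) :=
                   :ℕ 2 :* :K s x :* b :- :Z s x a b)
                 refl s x (fromℕ a) (fromℕ b)))
        in l , m , l≤a , m≤b ,
        completed-≥ 0<K 0<Q (complete-square (fromℕ a) (fromℕ b) (fromℕ l) (fromℕ m))
          (square-nonneg (Q * fromℕ b - V * (fromℕ a + fromℕ b))) (deviation-≤ closeₗ closeₘ)

      -- When l* < 0 the adversary takes l = 0 and m near b / W.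
      lower-few-tests-rest : ∀ a b m → Y (fromℕ a) (fromℕ b) ≤ 0# →
        let A = fromℕ a; B = fromℕ b; M = fromℕ m in
        0# ≤ W * core s A B 0# M + x * ((W * M - B) * (W * M - B))
      lower-few-tests-rest a b m Y≤0 =
        let A = fromℕ a; B = fromℕ b; M = fromℕ m in
        -- Adding the rounding square removes m. What remains is expanded around the boundary Y = 0:
        -- its value there is a multiple of (x - W)², and the other term has the factor -Y.
        *-cancelˡ-nonneg (*-pos (*-pos 0<V 0<V) 0<Q) (nonneg-by
          (x≤y⇒0≤y-x W≤x ⊗ <⇒≤ 0<Q ⊗ x≤y⇒0≤y-x Y≤0
              ⊗ (fromℕ-nonneg b ⊗ <⇒≤ 0<V ⊕ <⇒≤ 0<W ⊗ (fromℕ-nonneg a ⊕ fromℕ-nonneg b))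
            ⊕ <⇒≤ 0<W ⊗ square-nonneg (A + B) ⊗ square-nonneg (x - W) ⊗ <⇒≤ 0<K)
          (absorb-zero (difference-zero spQ≈)
            (solve 6 (λ p x s a b m →
              let K = :K s x; W = :W s x; V = :V s x; Q = :Q s x; n = a :+ b in
              (x :- W) :* Q :* (:0 :- :Y s x a b) :* (b :* V :+ W :* n)
                :+ W :* :sq n :* :sq (x :- W) :* K
              := V :* V :* Q :* (W :* :core p x s a b :0 m :+ x :* :sq (W :* m :- b))
                 :+ (:- (V :* V :* W :* :sq n)) :* (V :* (x :- :1) :- s :* (p :* Q)))
              refl p x s A B M)))

      lower-few-tests : ∀ a b → Y (fromℕ a) (fromℕ b) ≤ 0# →
        ∃[ m ] m ℕ.≤ b × - (x * W) ≤ core s (fromℕ a) (fromℕ b) 0# (fromℕ m)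
      lower-few-tests a b Y≤0 =
        let m , m≤b , close = round-quotient b 0<W (fromℕ-nonneg b) (≤-by
              (fromℕ-nonneg b ⊗ (0≤1 ⊕ 0≤s))
              (solve 2 (λ s b → b :* (:1 :+ s) := (:ℕ 2 :+ s) :* b :- b) refl s (fromℕ b)))
        in m , m≤b , rounding-loss 0<W 0≤x (lower-few-tests-rest a b m Y≤0) close

      -- When m* < 0 the adversary takes m = 0 and l near a / C.
      lower-many-tests-rest : ∀ a b l → Z (fromℕ a) (fromℕ b) ≤ 0# →
        let A = fromℕ a; B = fromℕ b; L = fromℕ l in
        0# ≤ C * core s A B L 0# + 1# * ((C * L - A) * (C * L - A))
      lower-many-tests-rest a b l Z≤0 =
        let A = fromℕ a; B = fromℕ b; L = fromℕ l in
        -- The same expansion around Z = 0, after the rounding square has removed l.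
        *-cancelˡ-nonneg (*-pos (*-pos (*-pos 0<2 0<x) 0<D) 0<D) (nonneg-by
          (0≤2 ⊗ (square-nonneg (A + B) ⊗ square-nonneg (s + 1#) ⊗ <⇒≤ 0<K)
            ⊕ 0≤x ⊗ x≤y⇒0≤y-x Z≤0 ⊗ (0≤sx ⊗ <⇒≤ 0<D ⊗ fromℕ-nonneg b
                ⊕ (<⇒≤ 0<C ⊗ 0≤s ⊕ <⇒≤ 0<D ⊕ <⇒≤ 0<C) ⊗ (fromℕ-nonneg a ⊕ fromℕ-nonneg b)))
          (absorb-zero (difference-zero spQ≈)
            (solve 6 (λ p x s a b l →
              let K = :K s x; V = :V s x; Q = :Q s x; C = :C s x; D = :D s x; n = a :+ b in
              :ℕ 2 :* (:sq n :* :sq (s :+ :1) :* K)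
                :+ x :* (:0 :- :Z s x a b) :* (s :* x :* D :* b :+ (C :* s :+ D :+ C) :* n)
              := :ℕ 2 :* x :* D :* D :* (C :* :core p x s a b l :0 :+ :1 :* :sq (C :* l :- a))
                 :+ (:- (:ℕ 2 :* D :* D :* :sq n)) :* (V :* (x :- :1) :- s :* (p :* Q)))
              refl p x s A B L)))

      lower-many-tests : ∀ a b → Z (fromℕ a) (fromℕ b) ≤ 0# →
        ∃[ l ] l ℕ.≤ a × - (1# * C) ≤ core s (fromℕ a) (fromℕ b) (fromℕ l) 0#
      lower-many-tests a b Z≤0 =
        let l , l≤a , close = round-quotient a 0<C (fromℕ-nonneg a) (≤-by
              (fromℕ-nonneg a ⊗ 0≤sx)
              (solve 3 (λ s x a → a :* (s :* x) := (:1 :+ s :* x) :* a :- a) refl s x (fromℕ a)))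
        in l , l≤a , rounding-loss 0<C 0≤1 (lower-many-tests-rest a b l Z≤0) close

      -- The rounding losses of the three cases are added, so that one constant serves whichever
      -- case holds.
      slack₁ slack : Carrier
      slack₁ = 1# + fromℕ 2 * x + fromℕ 4 * (s * x)
      slack  = slack₁ + x * W + 1# * C

      0≤slack₁ : 0# ≤ slack₁
      0≤slack₁ = 0≤1 ⊕ 0≤2 ⊗ 0≤x ⊕ fromℕ-nonneg 4 ⊗ 0≤sx

      0≤xW : 0# ≤ x * W
      0≤xW = 0≤x ⊗ <⇒≤ 0<W

      0≤1C : 0# ≤ 1# * C
      0≤1C = 0≤1 ⊗ <⇒≤ 0<C

      weaken : ∀ {e e′ y} → 0# ≤ e′ - e → - e ≤ y → - e′ ≤ y
      weaken {e} {e′} {y} 0≤e′-e -e≤y = ≤-by (x≤y⇒0≤y-x -e≤y ⊕ 0≤e′-e)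
        (solve 3 (λ e e′ y → (y :- (:- e)) :+ (e′ :- e) := y :- (:- e′)) refl e e′ y)

      lower : ∀ a b → ¬ ¬ (∃[ l ] ∃[ m ] l ℕ.≤ a × m ℕ.≤ b ×
        - slack ≤ core s (fromℕ a) (fromℕ b) (fromℕ l) (fromℕ m))
      -- The signs are never decided. `0≤Y` and `0≤Z` are negations, so the cases `Y<0` and `Z<0`
      -- may refute themselves by handing `k` their own witness.
      lower a b k = k (interior (lower-interior a b 0≤Y 0≤Z))
        where
        slack₁≤slack : 0# ≤ slack - slack₁
        slack₁≤slack = nonneg-by (0≤xW ⊕ 0≤1C)
          (solve 3 (λ e y z → y :+ z := (e :+ y :+ z) :- e) refl slack₁ (x * W) (1# * C))

        xW≤slack : 0# ≤ slack - x * W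
        xW≤slack = nonneg-by (0≤slack₁ ⊕ 0≤1C)
          (solve 3 (λ e y z → e :+ z := (e :+ y :+ z) :- y) refl slack₁ (x * W) (1# * C))

        C≤slack : 0# ≤ slack - 1# * C
        C≤slack = nonneg-by (0≤slack₁ ⊕ 0≤xW)
          (solve 3 (λ e y z → e :+ y := (e :+ y :+ z) :- z) refl slack₁ (x * W) (1# * C))

        interior : ∃[ l ] ∃[ m ] l ℕ.≤ a × m ℕ.≤ b ×
          - slack₁ ≤ core s (fromℕ a) (fromℕ b) (fromℕ l) (fromℕ m) →
          ∃[ l ] ∃[ m ] l ℕ.≤ a × m ℕ.≤ b ×
          - slack ≤ core s (fromℕ a) (fromℕ b) (fromℕ l) (fromℕ m)
        interior (l , m , l≤a , m≤b , bound) = l , m , l≤a , m≤b , weaken slack₁≤slack bound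

        0≤Y : 0# ≤ Y (fromℕ a) (fromℕ b)
        0≤Y Y<0 =
          let m , m≤b , bound = lower-few-tests a b (<⇒≤ Y<0) in k (0 , m , z≤n , m≤b , weaken xW≤slack bound)

        0≤Z : 0# ≤ Z (fromℕ a) (fromℕ b)
        0≤Z Z<0 =
          let l , l≤a , bound = lower-many-tests a b (<⇒≤ Z<0) in k (l , 0 , l≤a , z≤n , weaken C≤slack bound)

    ρ⟶ : ∀ 0≤x → (λ m → ρ p x 0<p 0≤x (suc m)) ⟶ 1# + s
    ρ⟶ 0≤x = ρ⟶1+s 0<p 0≤x s Q slack 0≤s (<⇒≤ 0<Q) (0≤slack₁ ⊕ 0≤xW ⊕ 0≤1C) upper lower

-- The closed forms as roots of the equations for s.

module NoTestsRatio {c ℓ₁ ℓ₂} (R : RealField c ℓ₁ ℓ₂) (p x : RealField.Carrier R) where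
  open RealField R hiding (zero)
  open RealFieldProperties R
  open IntegerCoefficients commutativeRing
  open OrderedField R

  module _ {L q : Carrier} (LL≈1+q : L * L ≈ 1# + q) (pq≈x : p * q ≈ x) where

    -- With s = L - 1 one has s (2 + s) = L² - 1 = x / p.
    root-equation : x ≈ p * (L - 1#) * (fromℕ 2 + (L - 1#))
    root-equation = trans (sym pq≈x) (absorb-zero (difference-zero LL≈1+q)
      (solve 3 (λ p q L → p :* q :=
          p :* (L :- :1) :* (:ℕ 2 :+ (L :- :1)) :+ (:- p) :* (L :* L :- (:1 :+ q)))
        refl p q L))

    root-nonneg : 0# ≤ L → 0# ≤ q → 0# ≤ L - 1#
    root-nonneg 0≤L 0≤q L<1 = <-irrefl
      (sym (absorb-zero (difference-zero LL≈1+q)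
        (solve 2 (λ q L → (:- (L :- :1)) :* (:1 :+ L) :+ q :=
            con (+ 0) :+ (:- :1) :* (L :* L :- (:1 :+ q))) refl q L)))
      (pos+nonneg (*-pos (neg-pos L<1) (pos+nonneg 0<1 0≤L)) 0≤q)

  -- Since p x = s p (s p + 2p), having s p > 1 would give p x > 1 + 2p, that is x > 2 + 1/p.
  sp≤1 : ∀ {i s} → 0# < p → 0# ≤ s → p * i ≈ 1# → x ≈ p * s * (fromℕ 2 + s) →
    x < fromℕ 2 + i → s * p ≤ 1#
  sp≤1 {i} {s} 0<p 0≤s pi≈1 x≈psw x<2+i 1<sp = <-irrefl
    (sym (absorb-zero (difference-zero pi≈1) (absorb-zero (difference-zero x≈psw)
      (solve 4 (λ p x s i →
        (s :* p :- :1) :* (:1 :+ (s :* p :+ :ℕ 2 :* p)) :+ p :* ((:ℕ 2 :+ i) :- x)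
        := con (+ 0) :+ :1 :* (p :* i :- :1) :+ (:- p) :* (x :- p :* s :* (:ℕ 2 :+ s)))
        refl p x s i))))
    (pos+nonneg
      (*-pos (x<y⇒0<y-x 1<sp) (pos+nonneg 0<1 (0≤s ⊗ <⇒≤ 0<p ⊕ 0≤2 ⊗ <⇒≤ 0<p)))
      (<⇒≤ 0<p ⊗ <⇒≤ (x<y⇒0<y-x x<2+i)))

module SomeTestsRatio {c ℓ₁ ℓ₂} (R : RealField c ℓ₁ ℓ₂) (p x i r s : RealField.Carrier R) where
  open RealField R hiding (zero)
  open RealFieldProperties R
  open IntegerCoefficients commutativeRing
  open OrderedField R

  -- `Δ` is the discriminant of `quadratic` in s, its last square being B².
  B Δ quadratic : Carrier
  B = x ² - p * x - 1#
  Δ = fromℕ 8 * p * (x - 1#) * x ² + (1# + p * x - x ²) ²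
  quadratic = p * (x * x) * (s * s) - B * s - fromℕ 2 * (x - 1#)

  private
    :B :Δ : ∀ {n} → (p x : Polynomial n) → Polynomial n
    :B p x = x :* x :- p :* x :- :1
    :Δ p x = :ℕ 8 :* p :* (x :- :1) :* (x :* x)
      :+ (:1 :+ p :* x :- x :* x) :* (:1 :+ p :* x :- x :* x)

    :quadratic : ∀ {n} → (p x s : Polynomial n) → Polynomial n
    :quadratic p x s = p :* (x :* x) :* (s :* s) :- :B p x :* s :- :ℕ 2 :* (x :- :1)

  module _ (0<p : 0# < p) (0<i : 0# < i) (2+i≤x : fromℕ 2 + i ≤ x) where

    private
      0<x-2 : 0# < x - fromℕ 2
      0<x-2 = <-respʳ (solve 2 (λ x i → i :+ (x :- (:ℕ 2 :+ i)) := x :- :ℕ 2) refl x i)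
        (pos+nonneg 0<i (x≤y⇒0≤y-x 2+i≤x))

      0<x-1 : 0# < x - 1#
      0<x-1 = <-respʳ (solve 1 (λ x → (x :- :ℕ 2) :+ :1 := x :- :1) refl x)
        (pos+nonneg 0<x-2 (<⇒≤ 0<1))

      0<x : 0# < x
      0<x = <-respʳ (solve 1 (λ x → (x :- :ℕ 2) :+ :ℕ 2 := x) refl x) (pos+nonneg 0<x-2 0≤2)

      0≤8p[x-1]x² : 0# ≤ fromℕ 8 * p * (x - 1#) * x ²
      0≤8p[x-1]x² = fromℕ-nonneg 8 ⊗ <⇒≤ 0<p ⊗ <⇒≤ 0<x-1 ⊗ square-nonneg x

    Δ-nonneg : 0# ≤ Δ
    Δ-nonneg = 0≤8p[x-1]x² ⊕ square-nonneg (1# + p * x - x ²)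

    module _ (0≤r : 0# ≤ r) (rr≈Δ : r * r ≈ Δ) where

      -- r² - B² = 8p (x - 1) x² ≥ 0, so r dominates B in absolute value. This sign yields s ≥ 0,
      -- the opposite one 2 + s ≤ x.
      B+r-nonneg : 0# ≤ B + r
      B+r-nonneg = square-≤⇒0≤+ 0≤r (≤-by 0≤8p[x-1]x²
        (absorb-zero (difference-zero rr≈Δ)
          (solve 3 (λ p x r → :ℕ 8 :* p :* (x :- :1) :* (x :* x) :=
              (r :* r :- :B p x :* :B p x) :+ (:- :1) :* (r :* r :- :Δ p x)) refl p x r)))

      -B+r-nonneg : 0# ≤ - B + r
      -B+r-nonneg = square-≤⇒0≤+ 0≤r (≤-by 0≤8p[x-1]x²
        (absorb-zero (difference-zero rr≈Δ)
          (solve 3 (λ p x r → :ℕ 8 :* p :* (x :- :1) :* (x :* x) :=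
              (r :* r :- (:- :B p x) :* (:- :B p x)) :+ (:- :1) :* (r :* r :- :Δ p x)) refl p x r)))

      module _ (Ms≈B+r : fromℕ 2 * p * x ² * s ≈ B + r) where

        -- With M = 2 p x², completing the square gives 2M times the quadratic as (M s - B)² - Δ.
        quadratic≈0 : quadratic ≈ 0#
        quadratic≈0 = *-cancelˡ-≈0 (*-pos 0<2 (*-pos (*-pos 0<2 0<p) (*-pos 0<x 0<x)))
          (absorb-zero (difference-zero rr≈Δ) (absorb-zero (difference-zero Ms≈B+r)
            (solve 4 (λ p x r s →
              let M = :ℕ 2 :* p :* (x :* x) in
              :ℕ 2 :* M :* :quadratic p x s :=
              con (+ 0) :+ :1 :* (r :* r :- :Δ p x)
                :+ (M :* s :- :B p x :+ r) :* (M :* s :- (:B p x :+ r)))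
              refl p x r s)))

        spQ≈ : (fromℕ 2 + s + s * x) * (x - 1#) ≈ s * (p * (x * (1# + s * x)))
        spQ≈ = absorb-zero quadratic≈0
          (solve 3 (λ p x s →
            (:ℕ 2 :+ s :+ s :* x) :* (x :- :1) :=
            s :* (p :* (x :* (:1 :+ s :* x))) :+ (:- :1) :* :quadratic p x s)
            refl p x s)

        -- The quadratic takes the value x (x - 1)² (p (x - 2) - 1) ≥ 0 at x - 2,
        -- and it increases from its larger root s on.
        2+s≤x : p * i ≈ 1# → fromℕ 2 + s ≤ x
        2+s≤x pi≈1 x<2+s = <-irrefl
          (sym (absorb-zero quadratic≈0 (absorb-zero (difference-zero pi≈1)
            (absorb-zero (difference-zero Ms≈B+r)
              (solve 5 (λ p x i r s →
                let M = :ℕ 2 :* p :* (x :* x) in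
                ((:ℕ 2 :+ s) :- x) :* (M :* (x :- :ℕ 2) :+ (:- :B p x :+ r))
                  :+ :ℕ 2 :* (x :* ((x :- :1) :* (x :- :1)) :* (p :* (x :- (:ℕ 2 :+ i))))
                := con (+ 0) :+ :ℕ 2 :* :quadratic p x s
                   :+ (:- (:ℕ 2 :* (x :* ((x :- :1) :* (x :- :1))))) :* (p :* i :- :1)
                   :+ (:- ((:ℕ 2 :+ s) :- x)) :* (M :* s :- (:B p x :+ r)))
                refl p x i r s)))))
          (pos+nonneg
            (*-pos (x<y⇒0<y-x x<2+s)
              (pos+nonneg (*-pos (*-pos (*-pos 0<2 0<p) (*-pos 0<x 0<x)) 0<x-2) -B+r-nonneg))
            (0≤2 ⊗ (<⇒≤ 0<x ⊗ square-nonneg (x - 1#)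
              ⊗ (<⇒≤ 0<p ⊗ x≤y⇒0≤y-x 2+i≤x))))

theorem2 :
  ∀ {c ℓ₁ ℓ₂} (R : RealField c ℓ₁ ℓ₂) →
  let open RealField R
      open Scheduling R
  in
  (p x : Carrier) (0<p : 0# < p) (0≤x : 0# ≤ x) →
  (x < fromℕ 2 + 1# / p [ 0<p ] →
    (λ m → ρ p x 0<p 0≤x (suc m)) ⟶ √ (1# + x / p [ 0<p ]))
  ×
  ((2+1/p≤x : fromℕ 2 + 1# / p [ 0<p ] ≤ x) →
    let Δ′ = fromℕ 8 * p * (x - 1#) * x ² + (1# + p * x - x ²) ²
    in
    (λ m → ρ p x 0<p 0≤x (suc m)) ⟶
      1# + (x ² - p * x - 1# + √ Δ′) / (fromℕ 2 * p * x ²) [ 2px²-pos 0<p 2+1/p≤x ])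
theorem2 R p x 0<p 0≤x = below , above
  where
  open RealField R hiding (zero)
  open RealFieldProperties R
  open IntegerCoefficients commutativeRing
  open OrderedField R
  open Scheduling R

  i : Carrier
  i = 1# / p [ 0<p ]

  pi≈1 : p * i ≈ 1#
  pi≈1 = *-/-cancel 1# 0<p

  below : x < fromℕ 2 + i → (λ m → ρ p x 0<p 0≤x (suc m)) ⟶ √ (1# + x / p [ 0<p ])
  below x<2+i = ⟶-resp-≈ (solve 1 (λ L → :1 :+ (L :- :1) := L) refl L)
    (NoTests.ρ⟶ R p x (L - 1#) 0<p 0≤x 0≤s (sp≤1 0<p 0≤s pi≈1 x≈psw x<2+i) x≈psw)
    where
    open NoTestsRatio R p x

    q L : Carrier
    q = x / p [ 0<p ]
    L = √ (1# + q)

    0≤q : 0# ≤ q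
    0≤q = /-nonneg 0<p 0≤x

    0≤L : 0# ≤ L
    0≤L = √-nonneg (<⇒≤ 0<1 ⊕ 0≤q)

    LL≈1+q : L * L ≈ 1# + q
    LL≈1+q = √-square (<⇒≤ 0<1 ⊕ 0≤q)

    0≤s : 0# ≤ L - 1#
    0≤s = root-nonneg LL≈1+q (*-/-cancel x 0<p) 0≤L 0≤q

    x≈psw : x ≈ p * (L - 1#) * (fromℕ 2 + (L - 1#))
    x≈psw = root-equation LL≈1+q (*-/-cancel x 0<p)

  above : (2+i≤x : fromℕ 2 + i ≤ x) →
    let Δ′ = fromℕ 8 * p * (x - 1#) * x ² + (1# + p * x - x ²) ² in
    (λ m → ρ p x 0<p 0≤x (suc m)) ⟶
      1# + (x ² - p * x - 1# + √ Δ′) / (fromℕ 2 * p * x ²) [ 2px²-pos 0<p 2+i≤x ]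
  above 2+i≤x = SomeTests.ρ⟶ R p x s 0<p
    (/-nonneg 0<M (B+r-nonneg 0<p 0<i 2+i≤x 0≤r rr≈Δ))
    (2+s≤x 0<p 0<i 2+i≤x 0≤r rr≈Δ Ms≈B+r pi≈1)
    (spQ≈ 0<p 0<i 2+i≤x 0≤r rr≈Δ Ms≈B+r)
    0≤x
    where
    0<i : 0# < i
    0<i = 1/-pos 0<p

    0<M : 0# < fromℕ 2 * p * x ²
    0<M = 2px²-pos 0<p 2+i≤x

    Δ′ r s : Carrier
    Δ′ = fromℕ 8 * p * (x - 1#) * x ² + (1# + p * x - x ²) ²
    r = √ Δ′
    s = (x ² - p * x - 1# + r) / (fromℕ 2 * p * x ²) [ 0<M ]

    open SomeTestsRatio R p x i r s

    0≤Δ : 0# ≤ Δ′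
    0≤Δ = Δ-nonneg 0<p 0<i 2+i≤x

    0≤r : 0# ≤ r
    0≤r = √-nonneg 0≤Δ

    rr≈Δ : r * r ≈ Δ′
    rr≈Δ = √-square 0≤Δ

    Ms≈B+r : fromℕ 2 * p * x ² * s ≈ x ² - p * x - 1# + r
    Ms≈B+r = *-/-cancel _ 0<M
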